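{- Let $b\ge 1$, let $\vec p=(p_1,\dots,p_b)$ with $p_i>0$ and $\sum_{i=1}^b p_i=1$, and let $0<\epsilon^+<1/8$; all of these are fixed constants. Let $n\to\infty$ through positive integers for which every $p_in$ is an integer, and let $u=u(n)$ be integers with $n/u\to 0$. For each such $n$ let $m=m(n)$ be such that there is a data structure with $m$-bit strings that $(\epsilon^+,0,0)$-encodes all $\vec p$-maps with $n$ keys from a universe of size $u$. Then the number of bits used per key satisfies $$\frac{m}{n}\ \ge\ \log\frac1{\epsilon^+}+H(\vec p)+o(1)\qquad (n\to\infty).$$
   Context: All logarithms are base two and $H(\vec p)=-\sum_{i=1}^b p_i\log p_i$. Let $U$ be a universe of size $u$ and $V=\{v_1,\dots,v_b\}$ a set of $b$ values, with $\bot\notin V$. A $\vec p$-map $M$ with $n$ keys is a set $\{(x,v(x)) : x\in X\}$ where $X\subseteq U$, $|X|=n$, $v:X\to V$, and $X_i=\{x\in X: v(x)=v_i\}$ satisfies $|X_i|=p_in$ for each $i\in[b]=\{1,\dots,b\}$. A data structure with $m$-bit strings is a fixed rule assigning to every $s\in\{0,1\}^m$ a function $s:U\to V\cup\{\bot\}$ (the answers to queries). For a string $s$ and a $\vec p$-map $M$ with key set $X$ define $$f^+(s)=\frac{|\{x\in U\setminus X: s(x)\ne\bot\}|}{|U\setminus X|},\quad f_i^*(s)=\frac{|\{x\in X_i: s(x)\in V\setminus\{v_i\}\}|}{|X_i|},\quad f_i^-(s)=\frac{|\{x\in X_i: s(x)=\bot\}|}{|X_i|}.$$ For constants $\epsilon^+>0$,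 $\epsilon^*,\epsilon^-\ge0$, the string $s$ $(\epsilon^+,\epsilon^*,\epsilon^-)$-encodes $M$ if $f^+(s)\le\epsilon^+$ and, for all $i\in[b]$, $f_i^*(s)\le\epsilon^*$ and $f_i^-(s)\le\epsilon^-$. The data structure $(\epsilon^+,\epsilon^*,\epsilon^-)$-encodes all $\vec p$-maps if for every $\vec p$-map $M$ with $n$ keys from $U$ there is $s\in\{0,1\}^m$ that $(\epsilon^+,\epsilon^*,\epsilon^-)$-encodes $M$. -}

module Defs where

open import Data.Bool using (Bool)
open import Data.Empty using (⊥-elim)
open import Data.Fin using (Fin)
import Data.Fin.Properties as Fin
open import Data.Integer as ℤ using (ℤ; +_; _⊖_)
import Data.Integer.Properties as ℤ
import Data.Integer.Solver as ℤSolver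
open import Data.Maybe using (Maybe; just; nothing)
import Data.Maybe.Properties as Maybe
open import Data.Nat as ℕ using (ℕ; zero; suc)
import Data.Nat.Properties as ℕ
open import Data.Product using (Σ; ∃₂; ∃-syntax; _×_; _,_; proj₁; proj₂)
open import Data.Rational
open import Data.Rational.Properties
import Data.Rational.Solver as ℚSolver
open import Data.Rational.Unnormalised as ℚᵘ using (mkℚᵘ)
import Data.Rational.Unnormalised.Properties as ℚᵘ
open import Data.Sum using (inj₁; inj₂)
open import Data.Vec using (Vec; allFin; count)
open import Data.Vec.Functional using (Vector; foldr)
open import Level using (0ℓ)
open import Relation.Binary.PropositionalEquality
open import Relation.Nullary using (¬_; Dec; yes; no; ¬?)
open import Relation.Nullary.Decidable using (from-yes; _×-dec_)
open import Relation.Unary using (Pred; Decidable)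

open import Algebra.Bundles using (CommutativeRing)
open import Algebra.Properties.Semiring.Exp (CommutativeRing.semiring +-*-commutativeRing) public
  using (_^_; ^-homo-*; ^-assocʳ)
open import Algebra.Properties.CommutativeSemiring.Exp (CommutativeRing.commutativeSemiring +-*-commutativeRing) public
  using (^-distrib-*)
import Algebra.Properties.Group (CommutativeRing.+-group +-*-commutativeRing) as ℚ-group

module RationalLemmas where

  open ℚSolver.+-*-Solver

  add-pos⇒< : ∀ {p q w} → 0ℚ < w → p + w ≡ q → p < q
  add-pos⇒< {p} {q} {w} 0<w eq = subst₂ _<_ (+-identityʳ p) eq (+-monoʳ-< p 0<w)

  add-nonNeg⇒≤ : ∀ {p q w} → 0ℚ ≤ w → p + w ≡ q → p ≤ q
  add-nonNeg⇒≤ {p} {q} {w} 0≤w eq = subst₂ _≤_ (+-identityʳ p) eq (+-monoʳ-≤ p 0≤w)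

  <⇒0<- : ∀ {p q} → p < q → 0ℚ < q - p
  <⇒0<- {p} {q} p<q = subst (_< q - p) (+-inverseʳ p) (+-monoˡ-< (- p) p<q)

  ≤⇒0≤- : ∀ {p q} → p ≤ q → 0ℚ ≤ q - p
  ≤⇒0≤- {p} {q} p≤q = subst (_≤ q - p) (+-inverseʳ p) (+-monoˡ-≤ (- p) p≤q)

  0<+ : ∀ {p q} → 0ℚ < p → 0ℚ < q → 0ℚ < p + q
  0<+ = +-mono-<

  0≤+ : ∀ {p q} → 0ℚ ≤ p → 0ℚ ≤ q → 0ℚ ≤ p + q
  0≤+ = +-mono-≤

  0<* : ∀ {p q} → 0ℚ < p → 0ℚ < q → 0ℚ < p * q
  0<* {p} {q} 0<p 0<q =
    positive⁻¹ (p * q) {{pos*pos⇒pos p {{positive 0<p}} q {{positive 0<q}}}}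

  0≤* : ∀ {p q} → 0ℚ ≤ p → 0ℚ ≤ q → 0ℚ ≤ p * q
  0≤* {p} {q} 0≤p 0≤q =
    nonNegative⁻¹ (p * q) {{nonNeg*nonNeg⇒nonNeg p {{nonNegative 0≤p}} q {{nonNegative 0≤q}}}}

  *-mono-≤ˡ : ∀ {r p q} → 0ℚ ≤ r → p ≤ q → r * p ≤ r * q
  *-mono-≤ˡ {r} 0≤r = *-monoˡ-≤-nonNeg r {{nonNegative 0≤r}}

  *-mono-≤ʳ : ∀ {r p q} → 0ℚ ≤ r → p ≤ q → p * r ≤ q * r
  *-mono-≤ʳ {r} 0≤r = *-monoʳ-≤-nonNeg r {{nonNegative 0≤r}}

  *-mono-<ˡ : ∀ {r p q} → 0ℚ < r → p < q → r * p < r * q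
  *-mono-<ˡ {r} 0<r = *-monoʳ-<-pos r {{positive 0<r}}

  *-mono-<ʳ : ∀ {r p q} → 0ℚ < r → p < q → p * r < q * r
  *-mono-<ʳ {r} 0<r = *-monoˡ-<-pos r {{positive 0<r}}

  <-⊓ : ∀ {z p q} → z < p → z < q → z < p ⊓ q
  <-⊓ {z} {p} {q} z<p z<q with ⊓-sel p q
  ... | inj₁ eq = subst (z <_) (sym eq) z<p
  ... | inj₂ eq = subst (z <_) (sym eq) z<q

  ⊔-< : ∀ {z p q} → p < z → q < z → p ⊔ q < z
  ⊔-< {z} {p} {q} p<z q<z with ⊔-sel p q
  ... | inj₁ eq = subst (_< z) (sym eq) p<z
  ... | inj₂ eq = subst (_< z) (sym eq) q<z

  between-lower : ∀ {z a t b} c → a ≤ t → t ≤ b → z ≤ a * c → z ≤ b * c → z ≤ t * c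
  between-lower c a≤t t≤b z≤ac z≤bc with ≤-total 0ℚ c
  ... | inj₁ 0≤c = ≤-trans z≤ac (*-mono-≤ʳ 0≤c a≤t)
  ... | inj₂ c≤0 = ≤-trans z≤bc (*-monoʳ-≤-nonPos c {{nonPositive c≤0}} t≤b)

  between-upper : ∀ {z a t b} c → a ≤ t → t ≤ b → a * c ≤ z → b * c ≤ z → t * c ≤ z
  between-upper c a≤t t≤b ac≤z bc≤z with ≤-total 0ℚ c
  ... | inj₁ 0≤c = ≤-trans (*-mono-≤ʳ 0≤c t≤b) bc≤z
  ... | inj₂ c≤0 = ≤-trans (*-monoʳ-≤-nonPos c {{nonPositive c≤0}} a≤t) ac≤z

  ^-pos : ∀ {r} n → 0ℚ < r → 0ℚ < r ^ n
  ^-pos zero    0<r = from-yes (0ℚ <? 1ℚ)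
  ^-pos (suc n) 0<r = 0<* 0<r (^-pos n 0<r)

  ^-mono-≤ : ∀ {r t} n → 0ℚ < r → r ≤ t → r ^ n ≤ t ^ n
  ^-mono-≤ zero    0<r r≤t = ≤-refl
  ^-mono-≤ (suc n) 0<r r≤t =
    ≤-trans (*-mono-≤ʳ (<⇒≤ (^-pos n 0<r)) r≤t)
            (*-mono-≤ˡ (<⇒≤ (<-≤-trans 0<r r≤t)) (^-mono-≤ n 0<r r≤t))

  ^-mono-< : ∀ {r t} n → 0ℚ < r → r < t → r ^ suc n < t ^ suc n
  ^-mono-< n 0<r r<t =
    <-≤-trans (*-mono-<ʳ (^-pos n 0<r) r<t)
              (*-mono-≤ˡ (<⇒≤ (<-trans 0<r r<t)) (^-mono-≤ n 0<r (<⇒≤ r<t)))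

  2ℚ : ℚ
  2ℚ = + 2 / 1

  0<2 : 0ℚ < 2ℚ
  0<2 = from-yes (0ℚ <? 2ℚ)

  1≤2^ : ∀ n → 1ℚ ≤ 2ℚ ^ n
  1≤2^ zero    = ≤-refl
  1≤2^ (suc n) = ≤-trans (1≤2^ n)
    (add-nonNeg⇒≤ (<⇒≤ (^-pos n 0<2)) (solve 1 (λ y → y :+ y := con 2ℚ :* y) refl (2ℚ ^ n)))

  2^-mono-≤ : ∀ {m n} → m ℕ.≤ n → 2ℚ ^ m ≤ 2ℚ ^ n
  2^-mono-≤ {n = n} ℕ.z≤n = 1≤2^ n
  2^-mono-≤ (ℕ.s≤s m≤n)   = *-mono-≤ˡ (<⇒≤ 0<2) (2^-mono-≤ m≤n)

  nat : ℕ → ℚ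
  nat zero    = 0ℚ
  nat (suc n) = 1ℚ + nat n

  0≤nat : ∀ n → 0ℚ ≤ nat n
  0≤nat zero    = ≤-refl
  0≤nat (suc n) = 0≤+ (from-yes (0ℚ ≤? 1ℚ)) (0≤nat n)

  0<nat-suc : ∀ n → 0ℚ < nat (suc n)
  0<nat-suc n = +-mono-<-≤ (from-yes (0ℚ <? 1ℚ)) (0≤nat n)

  bernoulli : ∀ {r t} d → 0ℚ < r → r ≤ t → t * t ^ d ≤ t * r ^ d + nat d * (t - r) * t ^ d
  bernoulli {r} {t} zero    0<r r≤t = ≤-reflexive
    (solve 2 (λ r t → t :* con 1ℚ := t :* con 1ℚ :+ con 0ℚ :* (t :- r) :* con 1ℚ) refl r t)
  bernoulli {r} {t} (suc d) 0<r r≤t = add-nonNeg⇒≤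
    (0≤+ (0≤* (<⇒≤ (<-≤-trans 0<r r≤t)) (≤⇒0≤- (bernoulli d 0<r r≤t)))
         (0≤* (0≤* (≤⇒0≤- r≤t) (<⇒≤ (<-≤-trans 0<r r≤t))) (≤⇒0≤- (^-mono-≤ d 0<r r≤t))))
    (solve 5 (λ r t R T n →
        t :* (t :* T) :+ (t :* ((t :* R :+ n :* (t :- r) :* T) :- t :* T)
                          :+ (t :- r) :* t :* (T :- R))
          := t :* (r :* R) :+ (con 1ℚ :+ n) :* (t :- r) :* (t :* T))
       refl r t (r ^ d) (t ^ d) (nat d))

  ^-doubling : ∀ {r t} d → 0ℚ < r → r ≤ t → (t - r) * (2ℚ * nat d) ≤ t → t ^ d ≤ 2ℚ * r ^ d
  ^-doubling {r} {t} d 0<r r≤t small =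
    *-cancelˡ-≤-pos t {{positive 0<t}} (add-nonNeg⇒≤
      (0≤+ (0≤* (<⇒≤ 0<2) (≤⇒0≤- (bernoulli d 0<r r≤t)))
           (0≤* (<⇒≤ (^-pos d 0<t)) (≤⇒0≤- small)))
      (solve 5 (λ r t R T n →
          t :* T :+ (con 2ℚ :* ((t :* R :+ n :* (t :- r) :* T) :- t :* T)
                     :+ T :* (t :- (t :- r) :* (con 2ℚ :* n)))
            := t :* (con 2ℚ :* R))
         refl r t (r ^ d) (t ^ d) (nat d)))
    where 0<t = <-≤-trans 0<r r≤t

  /-mono⁻¹-< : ∀ {a b : ℤ} {d e} → a / suc d < b / suc e →
               a ℤ.* + suc e ℤ.< b ℤ.* + suc d
  /-mono⁻¹-< {a} {b} {d} {e} lt = ℚᵘ.drop-*<*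
    (ℚᵘ.<-respˡ-≃ (toℚᵘ-fromℚᵘ (mkℚᵘ a d))
      (ℚᵘ.<-respʳ-≃ (toℚᵘ-fromℚᵘ (mkℚᵘ b e)) (toℚᵘ-mono-< lt)))

  /-mono-< : ∀ {a b : ℤ} {d e} → a ℤ.* + suc e ℤ.< b ℤ.* + suc d → a / suc d < b / suc e
  /-mono-< {a} {b} {d} {e} lt = toℚᵘ-cancel-<
    (ℚᵘ.<-respˡ-≃ (ℚᵘ.≃-sym (toℚᵘ-fromℚᵘ (mkℚᵘ a d)))
      (ℚᵘ.<-respʳ-≃ (ℚᵘ.≃-sym (toℚᵘ-fromℚᵘ (mkℚᵘ b e))) (ℚᵘ.*<* lt)))

  /-homo-+ : ∀ (a b : ℤ) d → (a ℤ.+ b) / suc d ≡ a / suc d + b / suc d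
  /-homo-+ a b d = toℚᵘ-injective (begin
    toℚᵘ ((a ℤ.+ b) / suc d)
      ≈⟨ toℚᵘ-fromℚᵘ (mkℚᵘ (a ℤ.+ b) d) ⟩
    mkℚᵘ (a ℤ.+ b) d
      ≈⟨ ℚᵘ.*≡* (ℤsolve a b (+ suc d)) ⟩
    mkℚᵘ a d ℚᵘ.+ mkℚᵘ b d
      ≈⟨ ℚᵘ.+-cong (toℚᵘ-fromℚᵘ (mkℚᵘ a d)) (toℚᵘ-fromℚᵘ (mkℚᵘ b d)) ⟨
    toℚᵘ (a / suc d) ℚᵘ.+ toℚᵘ (b / suc d)
      ≈⟨ toℚᵘ-homo-+ (a / suc d) (b / suc d) ⟨
    toℚᵘ (a / suc d + b / suc d) ∎)
    where
    open import Relation.Binary.Reasoning.Setoid ℚᵘ.≃-setoid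
    ℤsolve : ∀ a b c → (a ℤ.+ b) ℤ.* (c ℤ.* c) ≡ (a ℤ.* c ℤ.+ b ℤ.* c) ℤ.* c
    ℤsolve = ℤS.solve 3 (λ a b c → (a ℤS.:+ b) ℤS.:* (c ℤS.:* c)
                            ℤS.:= (a ℤS.:* c ℤS.:+ b ℤS.:* c) ℤS.:* c) refl
      where module ℤS = ℤSolver.+-*-Solver

  archimedean : ∀ {e} → 0ℚ < e → ∃[ d ] + 4 / suc d < e
  archimedean {mkℚ (+ zero)    d c} (*<* (ℤ.+<+ ()))
  archimedean {mkℚ ℤ.-[1+ n ]  d c} (*<* ())
  archimedean {e@(mkℚ (+ suc n) d c)} _ = 4 ℕ.* suc d ,
    subst (+ 4 / suc (4 ℕ.* suc d) <_) (fromℚᵘ-toℚᵘ e)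
      (/-mono-< {+ 4} {+ suc n} {4 ℕ.* suc d} {d} (subst₂ ℤ._<_ (ℤ.pos-* 4 (suc d)) (ℤ.pos-* (suc n) _)
        (ℤ.+<+ (ℕ.≤-trans (ℕ.≤-refl {suc (4 ℕ.* suc d)}) (ℕ.m≤m+n _ (n ℕ.* suc (4 ℕ.* suc d)))))))

  ∃2^> : ∀ p → ∃[ n ] p < 2ℚ ^ n
  ∃2^> p@(mkℚ a d _) = n , <-≤-trans p<n (n≤2^n n)
    where
    n : ℕ
    n = suc ℤ.∣ a ∣
    n≤2^n : ∀ n → nat n ≤ 2ℚ ^ n
    n≤2^n zero    = from-yes (0ℚ ≤? 1ℚ)
    n≤2^n (suc n) = ≤-trans (+-mono-≤ (1≤2^ n) (n≤2^n n))
      (≤-reflexive (solve 1 (λ y → y :+ y := con 2ℚ :* y) refl (2ℚ ^ n)))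
    nat≡ : ∀ n → nat n ≡ + n / 1
    nat≡ zero    = refl
    nat≡ (suc n) = trans (cong (λ q → 1ℚ + q) (nat≡ n)) (sym (/-homo-+ (+ 1) (+ n) 0))
    below : ∀ (a : ℤ) d → a ℤ.* + 1 ℤ.< + suc ℤ.∣ a ∣ ℤ.* + suc d
    below (+ a) d = subst₂ ℤ._<_ (sym (ℤ.*-identityʳ (+ a))) (ℤ.pos-* (suc a) (suc d))
      (ℤ.+<+ (ℕ.≤-trans (ℕ.≤-reflexive (sym (ℕ.*-identityʳ (suc a))))
                        (ℕ.*-monoʳ-≤ (suc a) (ℕ.s≤s ℕ.z≤n))))
    below ℤ.-[1+ a ] d = ℤ.-<+
    p<n : p < nat n
    p<n = subst₂ _<_ (fromℚᵘ-toℚᵘ p) (sym (nat≡ n))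
      (/-mono-< {a} {+ n} {d} {0} (below a d))

  -- Every positive rational lies in [2 ^ a , 2 ^ (1 + a)) for some integer a = j - k.
  dyadic-range : ∀ {p} → 0ℚ < p →
    ∃₂ λ j k → 2ℚ ^ j ≤ p * 2ℚ ^ k × p * 2ℚ ^ k < 2ℚ ^ suc j
  dyadic-range {p} 0<p =
    let instance p≢0 = >-nonZero 0<p
        (k , 1/p<2^k) = ∃2^> (1/ p)
        (N , p2^k<2^N) = ∃2^> (p * 2ℚ ^ k)
        1≤p2^k = subst (_≤ p * 2ℚ ^ k) (*-inverseʳ p) (*-mono-≤ˡ (<⇒≤ 0<p) (<⇒≤ 1/p<2^k))
        (j , below , above) = search N 1≤p2^k p2^k<2^N
    in j , k , below , above
    where
    search : ∀ N {y} → 1ℚ ≤ y → y < 2ℚ ^ N → ∃[ j ] (2ℚ ^ j ≤ y × y < 2ℚ ^ suc j)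
    search zero    1≤y y<1 = ⊥-elim (<-irrefl refl (≤-<-trans 1≤y y<1))
    search (suc N) {y} 1≤y y<2^1+N with 2ℚ ^ N ≤? y
    ... | yes 2^N≤y = N , 2^N≤y , y<2^1+N
    ... | no  2^N≰y = search N 1≤y (≰⇒> 2^N≰y)

  ⊖-cross : ∀ a b c e f →
    (a ⊖ b) ℤ.* + c ℤ.+ (+ (b ℕ.* c) ℤ.+ + (e ℕ.* f)) ≡ + (a ℕ.* c ℕ.+ e ℕ.* f)
  ⊖-cross a b c e f = begin-equality
    (a ⊖ b) ℤ.* + c ℤ.+ (+ (b ℕ.* c) ℤ.+ + (e ℕ.* f))
      ≡⟨ cong₂ (λ z w → z ℤ.* + c ℤ.+ (w ℤ.+ + (e ℕ.* f))) (sym (ℤ.m-n≡m⊖n a b)) (ℤ.pos-* b c) ⟩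
    (+ a ℤ.- + b) ℤ.* + c ℤ.+ (+ b ℤ.* + c ℤ.+ + (e ℕ.* f))
      ≡⟨ ℤS.solve 4 (λ a b c g → (a ℤS.:- b) ℤS.:* c ℤS.:+ (b ℤS.:* c ℤS.:+ g)
                        ℤS.:= a ℤS.:* c ℤS.:+ g) refl (+ a) (+ b) (+ c) (+ (e ℕ.* f)) ⟩
    + a ℤ.* + c ℤ.+ + (e ℕ.* f)
      ≡⟨ cong (ℤ._+ + (e ℕ.* f)) (ℤ.pos-* a c) ⟨
    + (a ℕ.* c ℕ.+ e ℕ.* f) ∎
    where
    open ℤ.≤-Reasoning
    module ℤS = ℤSolver.+-*-Solver

  2^≤^-< : ∀ {r t} j k d j′ k′ d′ → 0ℚ < r → r < t →
    2ℚ ^ j ≤ r ^ suc d * 2ℚ ^ k → t ^ suc d′ * 2ℚ ^ k′ ≤ 2ℚ ^ j′ →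
    (j ⊖ k) / suc d ≤ (j′ ⊖ k′) / suc d′
  2^≤^-< {r} {t} j k d j′ k′ d′ 0<r r<t lower upper = ≮⇒≥ λ lt →
    <-irrefl refl (begin-strict
      2ℚ ^ (j ℕ.* D′ ℕ.+ k′ ℕ.* D)
        ≡⟨ split j D′ k′ D ⟩
      (2ℚ ^ j) ^ D′ * (2ℚ ^ k′) ^ D
        ≤⟨ *-mono-≤ʳ (<⇒≤ (^-pos D (^-pos k′ 0<2))) (^-mono-≤ D′ (^-pos j 0<2) lower) ⟩
      (r ^ D * 2ℚ ^ k) ^ D′ * (2ℚ ^ k′) ^ D
        ≡⟨ cong (_* (2ℚ ^ k′) ^ D) (^-distrib-* (r ^ D) (2ℚ ^ k) D′) ⟩
      (r ^ D) ^ D′ * (2ℚ ^ k) ^ D′ * (2ℚ ^ k′) ^ D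
        ≡⟨ cong (λ z → z * (2ℚ ^ k) ^ D′ * (2ℚ ^ k′) ^ D) (^-assocʳ r D D′) ⟩
      r ^ (D ℕ.* D′) * (2ℚ ^ k) ^ D′ * (2ℚ ^ k′) ^ D
        <⟨ *-mono-<ʳ (^-pos D (^-pos k′ 0<2)) (*-mono-<ʳ (^-pos D′ (^-pos k 0<2))
             (^-mono-< (d′ ℕ.+ d ℕ.* D′) 0<r r<t)) ⟩
      t ^ (D ℕ.* D′) * (2ℚ ^ k) ^ D′ * (2ℚ ^ k′) ^ D
        ≡⟨ cong (λ n → t ^ n * (2ℚ ^ k) ^ D′ * (2ℚ ^ k′) ^ D) (ℕ.*-comm D D′) ⟩
      t ^ (D′ ℕ.* D) * (2ℚ ^ k) ^ D′ * (2ℚ ^ k′) ^ D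
        ≡⟨ cong (λ z → z * (2ℚ ^ k) ^ D′ * (2ℚ ^ k′) ^ D) (^-assocʳ t D′ D) ⟨
      (t ^ D′) ^ D * (2ℚ ^ k) ^ D′ * (2ℚ ^ k′) ^ D
        ≡⟨ solve 3 (λ x y z → x :* y :* z := x :* z :* y) refl
             ((t ^ D′) ^ D) ((2ℚ ^ k) ^ D′) ((2ℚ ^ k′) ^ D) ⟩
      (t ^ D′) ^ D * (2ℚ ^ k′) ^ D * (2ℚ ^ k) ^ D′
        ≡⟨ cong (_* (2ℚ ^ k) ^ D′) (^-distrib-* (t ^ D′) (2ℚ ^ k′) D) ⟨
      (t ^ D′ * 2ℚ ^ k′) ^ D * (2ℚ ^ k) ^ D′
        ≤⟨ *-mono-≤ʳ (<⇒≤ (^-pos D′ (^-pos k 0<2)))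
             (^-mono-≤ D (0<* (^-pos D′ (<-trans 0<r r<t)) (^-pos k′ 0<2)) upper) ⟩
      (2ℚ ^ j′) ^ D * (2ℚ ^ k) ^ D′
        ≡⟨ split j′ D k D′ ⟨
      2ℚ ^ (j′ ℕ.* D ℕ.+ k ℕ.* D′)
        ≤⟨ 2^-mono-≤ (exponents (/-mono⁻¹-< {j′ ⊖ k′} {j ⊖ k} {d′} {d} lt)) ⟩
      2ℚ ^ (j ℕ.* D′ ℕ.+ k′ ℕ.* D) ∎)
    where
    open ≤-Reasoning
    D D′ : ℕ
    D  = suc d
    D′ = suc d′
    split : ∀ a b c e → 2ℚ ^ (a ℕ.* b ℕ.+ c ℕ.* e) ≡ (2ℚ ^ a) ^ b * (2ℚ ^ c) ^ e
    split a b c e = trans (^-homo-* 2ℚ (a ℕ.* b) (c ℕ.* e))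
      (sym (cong₂ _*_ (^-assocʳ 2ℚ a b) (^-assocʳ 2ℚ c e)))
    exponents : (j′ ⊖ k′) ℤ.* + D ℤ.< (j ⊖ k) ℤ.* + D′ →
                j′ ℕ.* D ℕ.+ k ℕ.* D′ ℕ.≤ j ℕ.* D′ ℕ.+ k′ ℕ.* D
    exponents lt = ℤ.drop‿+≤+ (subst₂ ℤ._≤_ (⊖-cross j′ k′ D k D′)
      (trans (cong (λ z → (j ⊖ k) ℤ.* + D′ ℤ.+ z) (ℤ.+-comm (+ (k′ ℕ.* D)) (+ (k ℕ.* D′))))
             (⊖-cross j k D′ k′ D))
      (ℤ.<⇒≤ (ℤ.+-monoˡ-< (+ (k′ ℕ.* D) ℤ.+ + (k ℕ.* D′)) lt)))

  module Corners (p q r s : ℚ) where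

    ⊓≤₁ : (p ⊓ q) ⊓ (r ⊓ s) ≤ p
    ⊓≤₁ = ≤-trans (p⊓q≤p (p ⊓ q) (r ⊓ s)) (p⊓q≤p p q)
    ⊓≤₂ : (p ⊓ q) ⊓ (r ⊓ s) ≤ q
    ⊓≤₂ = ≤-trans (p⊓q≤p (p ⊓ q) (r ⊓ s)) (p⊓q≤q p q)
    ⊓≤₃ : (p ⊓ q) ⊓ (r ⊓ s) ≤ r
    ⊓≤₃ = ≤-trans (p⊓q≤q (p ⊓ q) (r ⊓ s)) (p⊓q≤p r s)
    ⊓≤₄ : (p ⊓ q) ⊓ (r ⊓ s) ≤ s
    ⊓≤₄ = ≤-trans (p⊓q≤q (p ⊓ q) (r ⊓ s)) (p⊓q≤q r s)

    ≤⊔₁ : p ≤ (p ⊔ q) ⊔ (r ⊔ s)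
    ≤⊔₁ = ≤-trans (p≤p⊔q p q) (p≤p⊔q (p ⊔ q) (r ⊔ s))
    ≤⊔₂ : q ≤ (p ⊔ q) ⊔ (r ⊔ s)
    ≤⊔₂ = ≤-trans (p≤q⊔p p q) (p≤p⊔q (p ⊔ q) (r ⊔ s))
    ≤⊔₃ : r ≤ (p ⊔ q) ⊔ (r ⊔ s)
    ≤⊔₃ = ≤-trans (p≤p⊔q r s) (p≤q⊔p (p ⊔ q) (r ⊔ s))
    ≤⊔₄ : s ≤ (p ⊔ q) ⊔ (r ⊔ s)
    ≤⊔₄ = ≤-trans (p≤q⊔p r s) (p≤q⊔p (p ⊔ q) (r ⊔ s))

open RationalLemmas

-- A real number is a two-sided Dedekind cut in ℚ.  Locatedness is stated in
-- its arithmetical form, from which the inhabitedness of both halves follows.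
record ℝ : Set₁ where
  field
    lower      : ℚ → Set
    upper      : ℚ → Set
    lower-down : ∀ {q r} → q < r → lower r → lower q
    lower-open : ∀ {q} → lower q → ∃[ r ] (q < r × lower r)
    upper-up   : ∀ {q r} → q < r → upper q → upper r
    upper-open : ∀ {r} → upper r → ∃[ q ] (q < r × upper q)
    disjoint   : ∀ {q r} → lower q → upper r → q < r
    located    : ∀ {e} → 0ℚ < e → ∃₂ λ q r → lower q × upper r × r - q < e

  lower-⊔ : ∀ {q r} → lower q → lower r → lower (q ⊔ r)
  lower-⊔ {q} {r} q∈ r∈ with ⊔-sel q r
  ... | inj₁ eq = subst lower (sym eq) q∈
  ... | inj₂ eq = subst lower (sym eq) r∈

  upper-⊓ : ∀ {q r} → upper q → upper r → upper (q ⊓ r)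
  upper-⊓ {q} {r} q∈ r∈ with ⊓-sel q r
  ... | inj₁ eq = subst upper (sym eq) q∈
  ... | inj₂ eq = subst upper (sym eq) r∈

open ℝ

infix  4 _≤ᵣ_ _≥ᵣ_ _<ᵣ_ _≃ᵣ_
infix  8 -ᵣ_
infixl 7 _*ᵣ_
infixl 6 _+ᵣ_ _-ᵣ_

_≤ᵣ_ _≥ᵣ_ _<ᵣ_ _≃ᵣ_ : ℝ → ℝ → Set
x ≤ᵣ y = ∀ {q} → lower x q → lower y q
x ≥ᵣ y = y ≤ᵣ x
x <ᵣ y = ∃[ q ] (upper x q × lower y q)
x ≃ᵣ y = x ≤ᵣ y × y ≤ᵣ x

fromℚ : ℚ → ℝ
fromℚ a .lower q = q < a
fromℚ a .upper r = a < r
fromℚ a .lower-down = <-trans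
fromℚ a .lower-open q<a = <-dense q<a
fromℚ a .upper-up q<r a<q = <-trans a<q q<r
fromℚ a .upper-open a<r = let (q , a<q , q<r) = <-dense a<r in q , q<r , a<q
fromℚ a .disjoint = <-trans
fromℚ a .located {e} 0<e =
  a - e * ¼ , a + e * ¼ ,
  add-pos⇒< 0<e/4 (solve 2 (λ a e → a :- e :* con ¼ :+ e :* con ¼ := a) refl a e) ,
  add-pos⇒< 0<e/4 refl ,
  add-pos⇒< (0<* 0<e (from-yes (0ℚ <? ½)))
    (solve 2 (λ a e → (a :+ e :* con ¼) :- (a :- e :* con ¼) :+ e :* con ½ := e) refl a e)
  where
  open ℚSolver.+-*-Solver
  ¼ = + 1 / 4
  0<e/4 = 0<* 0<e (from-yes (0ℚ <? ¼))

fromℕ : ℕ → ℝ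
fromℕ n = fromℚ (+ n / 1)

0ᵣ 1ᵣ : ℝ
0ᵣ = fromℚ 0ℚ
1ᵣ = fromℚ 1ℚ

-ᵣ_ : ℝ → ℝ
(-ᵣ x) .lower q = upper x (- q)
(-ᵣ x) .upper q = lower x (- q)
(-ᵣ x) .lower-down q<r = upper-up x (neg-antimono-< q<r)
(-ᵣ x) .lower-open {q} q∈ =
  let (r , r<-q , r∈) = upper-open x q∈
  in - r , subst (_< - r) (ℚ-group.⁻¹-involutive q) (neg-antimono-< r<-q) ,
     subst (upper x) (sym (ℚ-group.⁻¹-involutive r)) r∈
(-ᵣ x) .upper-up q<r = lower-down x (neg-antimono-< q<r)
(-ᵣ x) .upper-open {r} r∈ =
  let (q , -r<q , q∈) = lower-open x r∈
  in - q , subst (- q <_) (ℚ-group.⁻¹-involutive r) (neg-antimono-< -r<q) ,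
     subst (lower x) (sym (ℚ-group.⁻¹-involutive q)) q∈
(-ᵣ x) .disjoint {q} {r} q∈ r∈ =
  subst₂ _<_ (ℚ-group.⁻¹-involutive q) (ℚ-group.⁻¹-involutive r)
    (neg-antimono-< (disjoint x r∈ q∈))
(-ᵣ x) .located {e} 0<e =
  let (q , r , q∈ , r∈ , r-q<e) = located x 0<e
  in - r , - q , subst (upper x) (sym (ℚ-group.⁻¹-involutive r)) r∈ ,
     subst (lower x) (sym (ℚ-group.⁻¹-involutive q)) q∈ ,
     subst (_< e) (solve 2 (λ q r → r :- q := (:- q) :- (:- r)) refl q r) r-q<e
  where open ℚSolver.+-*-Solver

_+ᵣ_ : ℝ → ℝ → ℝ
(x +ᵣ y) .lower q = ∃₂ λ a b → lower x a × lower y b × q ≤ a + b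
(x +ᵣ y) .upper q = ∃₂ λ a b → upper x a × upper y b × a + b ≤ q
(x +ᵣ y) .lower-down q<r (a , b , a∈ , b∈ , r≤) = a , b , a∈ , b∈ , ≤-trans (<⇒≤ q<r) r≤
(x +ᵣ y) .lower-open (a , b , a∈ , b∈ , q≤) =
  let (a′ , a<a′ , a′∈) = lower-open x a∈
  in a′ + b , ≤-<-trans q≤ (+-monoˡ-< b a<a′) , a′ , b , a′∈ , b∈ , ≤-refl
(x +ᵣ y) .upper-up q<r (a , b , a∈ , b∈ , ≤q) = a , b , a∈ , b∈ , ≤-trans ≤q (<⇒≤ q<r)
(x +ᵣ y) .upper-open (a , b , a∈ , b∈ , ≤r) =
  let (a′ , a′<a , a′∈) = upper-open x a∈
  in a′ + b , <-≤-trans (+-monoˡ-< b a′<a) ≤r , a′ , b , a′∈ , b∈ , ≤-refl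
(x +ᵣ y) .disjoint (a , b , a∈ , b∈ , q≤) (a′ , b′ , a′∈ , b′∈ , ≤r) =
  ≤-<-trans q≤ (<-≤-trans (+-mono-< (disjoint x a∈ a′∈) (disjoint y b∈ b′∈)) ≤r)
(x +ᵣ y) .located {e} 0<e =
  let 0<e/2 = 0<* 0<e (from-yes (0ℚ <? ½))
      (a , a′ , a∈ , a′∈ , wx) = located x 0<e/2
      (b , b′ , b∈ , b′∈ , wy) = located y 0<e/2
  in a + b , a′ + b′ , (a , b , a∈ , b∈ , ≤-refl) , (a′ , b′ , a′∈ , b′∈ , ≤-refl) ,
     add-pos⇒< (0<+ (<⇒0<- wx) (<⇒0<- wy))
       (solve 5 (λ a a′ b b′ e →
           ((a′ :+ b′) :- (a :+ b)) :+ ((e :* con ½ :- (a′ :- a)) :+ (e :* con ½ :- (b′ :- b))) := e)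
          refl a a′ b b′ e)
  where open ℚSolver.+-*-Solver

_-ᵣ_ : ℝ → ℝ → ℝ
x -ᵣ y = x +ᵣ -ᵣ y

∑ : ∀ {b} → Vector ℝ b → ℝ
∑ = foldr _+ᵣ_ 0ᵣ

-- Multiplication is interval multiplication of rational boxes around (x , y).
record Box (x y : ℝ) : Set where
  field
    {a b c d} : ℚ
    a<x : lower x a
    x<b : upper x b
    c<y : lower y c
    y<d : upper y d

  min max : ℚ
  min = ((a * c) ⊓ (a * d)) ⊓ ((b * c) ⊓ (b * d))
  max = ((a * c) ⊔ (a * d)) ⊔ ((b * c) ⊔ (b * d))

  module _ {s t} (a≤s : a ≤ s) (s≤b : s ≤ b) (c≤t : c ≤ t) (t≤d : t ≤ d) where

    open Corners (a * c) (a * d) (b * c) (b * d)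

    min≤ : min ≤ s * t
    min≤ = between-lower t a≤s s≤b
      (subst (min ≤_) (*-comm t a) (between-lower a c≤t t≤d
        (subst (min ≤_) (*-comm a c) ⊓≤₁) (subst (min ≤_) (*-comm a d) ⊓≤₂)))
      (subst (min ≤_) (*-comm t b) (between-lower b c≤t t≤d
        (subst (min ≤_) (*-comm b c) ⊓≤₃) (subst (min ≤_) (*-comm b d) ⊓≤₄)))

    ≤max : s * t ≤ max
    ≤max = between-upper t a≤s s≤b
      (subst (_≤ max) (*-comm t a) (between-upper a c≤t t≤d
        (subst (_≤ max) (*-comm a c) ≤⊔₁) (subst (_≤ max) (*-comm a d) ≤⊔₂)))
      (subst (_≤ max) (*-comm t b) (between-upper b c≤t t≤d
        (subst (_≤ max) (*-comm b c) ≤⊔₃) (subst (_≤ max) (*-comm b d) ≤⊔₄)))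

module Boxes (x y : ℝ) where

  open Box

  min≤max : (B C : Box x y) → min B ≤ max C
  min≤max B C = ≤-trans
    (min≤ B (p≤p⊔q (a B) (a C)) (below x (a<x B) (a<x C) (x<b B))
            (p≤p⊔q (c B) (c C)) (below y (c<y B) (c<y C) (y<d B)))
    (≤max C (p≤q⊔p (a B) (a C)) (below x (a<x B) (a<x C) (x<b C))
            (p≤q⊔p (c B) (c C)) (below y (c<y B) (c<y C) (y<d C)))
    where
    below : ∀ z {p q r} → lower z p → lower z q → upper z r → p ⊔ q ≤ r
    below z p∈ q∈ r∈ = <⇒≤ (disjoint z (lower-⊔ z p∈ q∈) r∈)

  open ℚSolver.+-*-Solver

  Small : ℚ → ℚ → Set
  Small e s = s ≤ e * (+ 1 / 8) × - s ≤ e * (+ 1 / 8)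

  0-small : ∀ {e} → 0ℚ < e → Small e 0ℚ
  0-small 0<e = <⇒≤ 0<e/8 , <⇒≤ 0<e/8
    where 0<e/8 = 0<* 0<e (from-yes (0ℚ <? + 1 / 8))

  near : ∀ {m z} e s t → 0ℚ < e → Small e s → Small e t → m + (s + t) ≡ z →
         m - e * (+ 3 / 8) < z × z < m + e * (+ 3 / 8)
  near {m} e s t 0<e (s≤ , -s≤) (t≤ , -t≤) refl =
    add-pos⇒< (+-mono-<-≤ 0<e/8 (0≤+ (≤⇒0≤- -s≤) (≤⇒0≤- -t≤)))
      (solve 4 (λ m e s t →
          (m :- e :* con (+ 3 / 8)) :+ (e :* ⅛ :+ ((e :* ⅛ :- :- s) :+ (e :* ⅛ :- :- t)))
            := m :+ (s :+ t)) refl m e s t) ,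
    add-pos⇒< (+-mono-<-≤ 0<e/8 (0≤+ (≤⇒0≤- s≤) (≤⇒0≤- t≤)))
      (solve 4 (λ m e s t →
          (m :+ (s :+ t)) :+ (e :* ⅛ :+ ((e :* ⅛ :- s) :+ (e :* ⅛ :- t)))
            := m :+ e :* con (+ 3 / 8)) refl m e s t)
    where
    0<e/8 = 0<* 0<e (from-yes (0ℚ <? + 1 / 8))
    ⅛ : ∀ {n} → Polynomial n
    ⅛ = con (+ 1 / 8)

  narrow : ∀ p p′ q q′ → (q ⊓ q′) - (p ⊔ p′) ≤ q′ - p′
  narrow p p′ q q′ = +-mono-≤ (p⊓q≤q q q′) (neg-antimono-≤ (p≤q⊔p p p′))

  small-box : ∀ {e} → 0ℚ < e →
    Σ (Box x y) λ B → ∃₂ λ q r → q < min B × max B < r × r - q < e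
  small-box {e} 0<e
    with a₀ , b₀ , a₀∈ , b₀∈ , _ ← located x {1ℚ} (from-yes (0ℚ <? 1ℚ))
    with c₀ , d₀ , c₀∈ , d₀∈ , _ ← located y {1ℚ} (from-yes (0ℚ <? 1ℚ))
    = choose (located x 0<δ) (located y 0<δ)
    where
    K : ℚ
    K = 1ℚ ⊔ ((- a₀ ⊔ b₀) ⊔ (- c₀ ⊔ d₀))
    open Corners (- a₀) b₀ (- c₀) d₀
    -a₀≤K : - a₀ ≤ K
    -a₀≤K = ≤-trans ≤⊔₁ (p≤q⊔p 1ℚ _)
    b₀≤K : b₀ ≤ K
    b₀≤K = ≤-trans ≤⊔₂ (p≤q⊔p 1ℚ _)
    -c₀≤K : - c₀ ≤ K
    -c₀≤K = ≤-trans ≤⊔₃ (p≤q⊔p 1ℚ _)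
    d₀≤K : d₀ ≤ K
    d₀≤K = ≤-trans ≤⊔₄ (p≤q⊔p 1ℚ _)
    0<K : 0ℚ < K
    0<K = <-≤-trans (from-yes (0ℚ <? 1ℚ)) (p≤p⊔q 1ℚ ((- a₀ ⊔ b₀) ⊔ (- c₀ ⊔ d₀)))
    instance
      K>0 = positive 0<K
      K≢0 = pos⇒nonZero K
    δ : ℚ
    δ = (e * (+ 1 / 8)) * 1/ K
    Kδ≡e/8 : K * δ ≡ e * (+ 1 / 8)
    Kδ≡e/8 = trans (solve 3 (λ k e i → k :* (e :* i) := e :* (k :* i)) refl K (e * (+ 1 / 8)) (1/ K))
               (trans (cong (λ z → e * (+ 1 / 8) * z) (*-inverseʳ K)) (*-identityʳ _))
    0<δ : 0ℚ < δ
    0<δ = 0<* (0<* 0<e (from-yes (0ℚ <? + 1 / 8))) (positive⁻¹ (1/ K) {{1/pos⇒pos K}})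
    scale : ∀ {t w} → t ≤ K → 0ℚ ≤ w → w ≤ δ → t * w ≤ e * (+ 1 / 8)
    scale t≤K 0≤w w≤δ = ≤-trans (*-mono-≤ʳ 0≤w t≤K)
      (≤-trans (*-mono-≤ˡ (<⇒≤ 0<K) w≤δ) (≤-reflexive Kδ≡e/8))
    scaled : ∀ {t w} → t ≤ K → - t ≤ K → 0ℚ ≤ w → w ≤ δ → Small e (t * w)
    scaled {t} {w} t≤K -t≤K 0≤w w≤δ = scale t≤K 0≤w w≤δ ,
      subst (_≤ e * (+ 1 / 8)) (sym (neg-distribˡ-* t w)) (scale -t≤K 0≤w w≤δ)
    choose : (∃₂ λ q r → lower x q × upper x r × r - q < δ) →
             (∃₂ λ q r → lower y q × upper y r × r - q < δ) →
             Σ (Box x y) λ B → ∃₂ λ q r → q < min B × max B < r × r - q < e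
    choose (a₁ , b₁ , a₁∈ , b₁∈ , wx) (c₁ , d₁ , c₁∈ , d₁∈ , wy) =
      record { a<x = a∈ ; x<b = b∈ ; c<y = c∈ ; y<d = d∈ } ,
      aᵇ * cᵇ - e * (+ 3 / 8) , aᵇ * cᵇ + e * (+ 3 / 8) ,
      <-⊓ (<-⊓ (proj₁ ac) (proj₁ ad)) (<-⊓ (proj₁ bc) (proj₁ bd)) ,
      ⊔-< (⊔-< (proj₂ ac) (proj₂ ad)) (⊔-< (proj₂ bc) (proj₂ bd)) ,
      add-pos⇒< (0<* 0<e (from-yes (0ℚ <? + 1 / 4)))
        (solve 2 (λ z e → (z :+ e :* con (+ 3 / 8)) :- (z :- e :* con (+ 3 / 8))
                            :+ e :* con (+ 1 / 4) := e) refl (aᵇ * cᵇ) e)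
      where
      aᵇ bᵇ cᵇ dᵇ : ℚ
      aᵇ = a₀ ⊔ a₁
      bᵇ = b₀ ⊓ b₁
      cᵇ = c₀ ⊔ c₁
      dᵇ = d₀ ⊓ d₁
      a∈ = lower-⊔ x a₀∈ a₁∈
      b∈ = upper-⊓ x b₀∈ b₁∈
      c∈ = lower-⊔ y c₀∈ c₁∈
      d∈ = upper-⊓ y d₀∈ d₁∈
      0≤b-a = ≤⇒0≤- (<⇒≤ (disjoint x a∈ b∈))
      0≤d-c = ≤⇒0≤- (<⇒≤ (disjoint y c∈ d∈))
      b-a≤δ = ≤-trans (narrow a₀ a₁ b₀ b₁) (<⇒≤ wx)
      d-c≤δ = ≤-trans (narrow c₀ c₁ d₀ d₁) (<⇒≤ wy)
      a-small : Small e (aᵇ * (dᵇ - cᵇ))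
      a-small = scaled (≤-trans (<⇒≤ (disjoint x a∈ b₀∈)) b₀≤K)
                       (≤-trans (neg-antimono-≤ (p≤p⊔q a₀ a₁)) -a₀≤K) 0≤d-c d-c≤δ
      c-small : Small e (cᵇ * (bᵇ - aᵇ))
      c-small = scaled (≤-trans (<⇒≤ (disjoint y c∈ d₀∈)) d₀≤K)
                       (≤-trans (neg-antimono-≤ (p≤p⊔q c₀ c₁)) -c₀≤K) 0≤b-a b-a≤δ
      d-small : Small e (dᵇ * (bᵇ - aᵇ))
      d-small = scaled (≤-trans (p⊓q≤p d₀ d₁) d₀≤K)
                       (≤-trans (neg-antimono-≤ (<⇒≤ (disjoint y c₀∈ d∈))) -c₀≤K) 0≤b-a b-a≤δ
      ac = near {aᵇ * cᵇ} e 0ℚ 0ℚ 0<e (0-small 0<e) (0-small 0<e)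
        (solve 1 (λ z → z :+ (con 0ℚ :+ con 0ℚ) := z) refl (aᵇ * cᵇ))
      ad = near {aᵇ * cᵇ} e (aᵇ * (dᵇ - cᵇ)) 0ℚ 0<e a-small (0-small 0<e)
        (solve 3 (λ a c d → a :* c :+ (a :* (d :- c) :+ con 0ℚ) := a :* d) refl aᵇ cᵇ dᵇ)
      bc = near {aᵇ * cᵇ} e (cᵇ * (bᵇ - aᵇ)) 0ℚ 0<e c-small (0-small 0<e)
        (solve 3 (λ a b c → a :* c :+ (c :* (b :- a) :+ con 0ℚ) := b :* c) refl aᵇ bᵇ cᵇ)
      bd = near {aᵇ * cᵇ} e (aᵇ * (dᵇ - cᵇ)) (dᵇ * (bᵇ - aᵇ)) 0<e a-small d-small
        (solve 4 (λ a b c d → a :* c :+ (a :* (d :- c) :+ d :* (b :- a)) := b :* d) refl aᵇ bᵇ cᵇ dᵇ)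

_*ᵣ_ : ℝ → ℝ → ℝ
(x *ᵣ y) .lower q = Σ (Box x y) λ B → q < Box.min B
(x *ᵣ y) .upper q = Σ (Box x y) λ B → Box.max B < q
(x *ᵣ y) .lower-down q<r (B , r<) = B , <-trans q<r r<
(x *ᵣ y) .lower-open (B , q<) = let (r , q<r , r<) = <-dense q< in r , q<r , B , r<
(x *ᵣ y) .upper-up q<r (B , <q) = B , <-trans <q q<r
(x *ᵣ y) .upper-open (B , <r) = let (q , <q , q<r) = <-dense <r in q , q<r , B , <q
(x *ᵣ y) .disjoint (B , q<) (C , <r) = <-trans q< (≤-<-trans (Boxes.min≤max x y B C) <r)
(x *ᵣ y) .located 0<e =
  let (B , q , r , q< , <r , r-q<e) = Boxes.small-box x y 0<e
  in q , r , (B , q<) , (B , <r) , r-q<e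

-- For rationals r > x > 0, the inequality t * r ≤ 1 says t ≤ 1 / r < 1 / x.
inverse : (x : ℝ) → 0ᵣ <ᵣ x → ℝ
inverse x _ .lower q = ∃₂ λ r t → upper x r × t * r ≤ 1ℚ × q < t
inverse x _ .upper q = ∃₂ λ r t → lower x r × 0ℚ < r × 1ℚ ≤ t * r × t < q
inverse x _ .lower-down q<q′ (r , t , r∈ , tr≤1 , q′<t) = r , t , r∈ , tr≤1 , <-trans q<q′ q′<t
inverse x _ .lower-open (r , t , r∈ , tr≤1 , q<t) =
  let (q′ , q<q′ , q′<t) = <-dense q<t in q′ , q<q′ , r , t , r∈ , tr≤1 , q′<t
inverse x _ .upper-up q<q′ (r , t , r∈ , 0<r , 1≤tr , t<q) =
  r , t , r∈ , 0<r , 1≤tr , <-trans t<q q<q′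
inverse x _ .upper-open (r , t , r∈ , 0<r , 1≤tr , t<q) =
  let (q′ , t<q′ , q′<q) = <-dense t<q in q′ , q′<q , r , t , r∈ , 0<r , 1≤tr , t<q′
inverse x _ .disjoint (r , t , r∈ , tr≤1 , q<t) (r′ , t′ , r′∈ , 0<r′ , 1≤t′r′ , t′<q′) =
  <-trans q<t (<-trans (≰⇒> t′≰t) t′<q′)
  where
  t′≰t : ¬ t′ ≤ t
  t′≰t t′≤t = <-irrefl refl (begin-strict
    1ℚ      ≤⟨ 1≤t′r′ ⟩
    t′ * r′ ≤⟨ *-mono-≤ʳ (<⇒≤ 0<r′) t′≤t ⟩
    t * r′  <⟨ *-mono-<ˡ 0<t (disjoint x r′∈ r∈) ⟩
    t * r   ≤⟨ tr≤1 ⟩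
    1ℚ      ∎)
    where
    open ≤-Reasoning
    0<t : 0ℚ < t
    0<t = *-cancelʳ-<-nonNeg r′ {{nonNegative (<⇒≤ 0<r′)}}
      (≤-<-trans (≤-reflexive (*-zeroˡ r′))
        (<-≤-trans (from-yes (0ℚ <? 1ℚ)) (≤-trans 1≤t′r′ (*-mono-≤ʳ (<⇒≤ 0<r′) t′≤t))))
inverse x (s , 0<s , s∈) .located {e} 0<e =
  choose (located x (0<* (0<* 0<s 0<s) 0<e/2))
  where
  open ℚSolver.+-*-Solver
  ¼ : ℚ
  ¼ = + 1 / 4
  0<e/2 = 0<* 0<e (from-yes (0ℚ <? ½))
  0<e/4 = 0<* 0<e (from-yes (0ℚ <? ¼))
  choose : (∃₂ λ q r → lower x q × upper x r × r - q < s * s * (e * ½)) →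
           ∃₂ λ q r → lower (inverse x (s , 0<s , s∈)) q × upper (inverse x (s , 0<s , s∈)) r × r - q < e
  choose (r₀ , t , r₀∈ , t∈ , w) =
    1/ t - e * ¼ , 1/ r + e * ¼ ,
    (t , 1/ t , t∈ , ≤-reflexive (*-inverseˡ t) ,
      add-pos⇒< 0<e/4 (solve 2 (λ a b → a :- b :+ b := a) refl (1/ t) (e * ¼))) ,
    (r , 1/ r , r∈ , 0<r , ≤-reflexive (sym (*-inverseˡ r)) , add-pos⇒< 0<e/4 refl) ,
    add-pos⇒< (<⇒0<- gap)
      (solve 3 (λ v u e → ((u :+ e :* con ¼) :- (v :- e :* con ¼)) :+ (e :* con ½ :- (u :- v)) := e)
         refl (1/ t) (1/ r) e)
    where
    r : ℚ
    r = r₀ ⊔ s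
    r∈ = lower-⊔ x r₀∈ s∈
    s≤r : s ≤ r
    s≤r = p≤q⊔p r₀ s
    0<r : 0ℚ < r
    0<r = <-≤-trans 0<s s≤r
    r<t : r < t
    r<t = disjoint x r∈ t∈
    0<t : 0ℚ < t
    0<t = <-trans 0<r r<t
    instance
      r>0 = positive 0<r
      t>0 = positive 0<t
      r≢0 = pos⇒nonZero r
      t≢0 = pos⇒nonZero t
    t-r<rt[e/2] : t - r < r * t * (e * ½)
    t-r<rt[e/2] = ≤-<-trans (+-monoʳ-≤ t (neg-antimono-≤ (p≤p⊔q r₀ s)))
      (<-≤-trans w (*-mono-≤ʳ (<⇒≤ 0<e/2)
        (≤-trans (*-mono-≤ˡ (<⇒≤ 0<s) (≤-trans s≤r (<⇒≤ r<t))) (*-mono-≤ʳ (<⇒≤ 0<t) s≤r))))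
    gap : 1/ r - 1/ t < e * ½
    gap = *-cancelˡ-<-nonNeg (r * t) {{nonNegative (<⇒≤ (0<* 0<r 0<t))}} (subst (_< r * t * (e * ½))
      (trans (cong₂ (λ a b → t * a - r * b) (sym (*-inverseʳ r)) (sym (*-inverseʳ t)))
        (solve 4 (λ r t u v → t :* (r :* u) :- r :* (t :* v) := r :* t :* (u :- v)) refl r t (1/ r) (1/ t)))
      (subst (_< r * t * (e * ½)) (sym (cong₂ _-_ (*-identityʳ t) (*-identityʳ r))) t-r<rt[e/2]))

inverse-pos : (x : ℝ) (x>0 : 0ᵣ <ᵣ x) → 0ᵣ <ᵣ inverse x x>0
inverse-pos x (s , 0<s , s∈) with q , r , _ , r∈ , _ ← located x {1ℚ} (from-yes (0ℚ <? 1ℚ)) =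
  half , 0<half , r , 1/ r , r∈ , ≤-reflexive (*-inverseˡ r) , half<1/r
  where
  instance
    r>0 = positive (<-trans 0<s (disjoint x s∈ r∈))
    r≢0 = pos⇒nonZero r
  dense = <-dense (positive⁻¹ (1/ r) {{1/pos⇒pos r}})
  half = proj₁ dense
  0<half = proj₁ (proj₂ dense)
  half<1/r = proj₂ (proj₂ dense)

-- The base-two logarithm.  For a positive rational r, natural numbers j, k and
-- D = suc d, the inequality 2 ^ j ≤ r ^ D * 2 ^ k says (j - k) / D ≤ log r.
log : (x : ℝ) → 0ᵣ <ᵣ x → ℝ
log x _ .lower q = ∃[ r ] ∃[ j ] ∃[ k ] ∃[ d ]
  lower x r × 0ℚ < r × 2ℚ ^ j ≤ r ^ suc d * 2ℚ ^ k × q < (j ⊖ k) / suc d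
log x _ .upper q = ∃[ r ] ∃[ j ] ∃[ k ] ∃[ d ]
  upper x r × r ^ suc d * 2ℚ ^ k ≤ 2ℚ ^ j × (j ⊖ k) / suc d < q
log x _ .lower-down q<q′ (r , j , k , d , r∈ , 0<r , le , q′<) =
  r , j , k , d , r∈ , 0<r , le , <-trans q<q′ q′<
log x _ .lower-open (r , j , k , d , r∈ , 0<r , le , q<) =
  let (q′ , q<q′ , q′<) = <-dense q< in q′ , q<q′ , r , j , k , d , r∈ , 0<r , le , q′<
log x _ .upper-up q<q′ (r , j , k , d , r∈ , le , <q) =
  r , j , k , d , r∈ , le , <-trans <q q<q′
log x _ .upper-open (r , j , k , d , r∈ , le , <q) =
  let (q′ , <q′ , q′<q) = <-dense <q in q′ , q′<q , r , j , k , d , r∈ , le , <q′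
log x _ .disjoint (r , j , k , d , r∈ , 0<r , le , q<) (r′ , j′ , k′ , d′ , r′∈ , le′ , <q′) =
  <-trans q< (≤-<-trans (2^≤^-< j k d j′ k′ d′ 0<r (disjoint x r∈ r′∈) le le′) <q′)
log x (s , 0<s , s∈) .located {e} 0<e with d , 4/D<e ← archimedean 0<e =
  choose (located x 0<δ)
  where
  open ℚSolver.+-*-Solver
  D : ℕ
  D = suc d
  c : ℚ
  c = 2ℚ * nat D
  0<c : 0ℚ < c
  0<c = 0<* 0<2 (0<nat-suc d)
  instance
    c>0 = positive 0<c
    c≢0 = pos⇒nonZero c
  δ : ℚ
  δ = s * 1/ c
  0<δ : 0ℚ < δ
  0<δ = 0<* 0<s (positive⁻¹ (1/ c) {{1/pos⇒pos c}})
  δc≡s : δ * c ≡ s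
  δc≡s = trans (*-assoc s (1/ c) c) (trans (cong (s *_) (*-inverseˡ c)) (*-identityʳ s))
  1/D : ℚ
  1/D = + 1 / D
  0<1/D : 0ℚ < 1/D
  0<1/D = positive⁻¹ 1/D {{normalize-pos 1 D}}
  choose : (∃₂ λ q r → lower x q × upper x r × r - q < δ) →
           ∃₂ λ q r → lower (log x (s , 0<s , s∈)) q × upper (log x (s , 0<s , s∈)) r × r - q < e
  choose (r₀ , t , r₀∈ , t∈ , w) = found (dyadic-range (^-pos D 0<r))
    where
    r : ℚ
    r = r₀ ⊔ s
    r∈ = lower-⊔ x r₀∈ s∈
    0<r : 0ℚ < r
    0<r = <-≤-trans 0<s (p≤q⊔p r₀ s)
    r<t : r < t
    r<t = disjoint x r∈ t∈
    [t-r]c≤t : (t - r) * c ≤ t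
    [t-r]c≤t = begin
      (t - r) * c  ≤⟨ *-mono-≤ʳ (<⇒≤ 0<c) (+-monoʳ-≤ t (neg-antimono-≤ (p≤p⊔q r₀ s))) ⟩
      (t - r₀) * c ≤⟨ *-mono-≤ʳ (<⇒≤ 0<c) (<⇒≤ w) ⟩
      δ * c        ≡⟨ δc≡s ⟩
      s            ≤⟨ p≤q⊔p r₀ s ⟩
      r            ≤⟨ <⇒≤ r<t ⟩
      t            ∎
      where open ≤-Reasoning
    found : (∃₂ λ j k → 2ℚ ^ j ≤ r ^ D * 2ℚ ^ k × r ^ D * 2ℚ ^ k < 2ℚ ^ suc j) →
            ∃₂ λ q r → lower (log x (s , 0<s , s∈)) q × upper (log x (s , 0<s , s∈)) r × r - q < e
    found (j , k , below , above) =
      A - 1/D , A′ + 1/D ,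
      (r , j , k , d , r∈ , 0<r , below ,
        add-pos⇒< 0<1/D (solve 2 (λ a b → a :- b :+ b := a) refl A 1/D)) ,
      (t , suc (suc j) , k , d , t∈ , t^D≤ , add-pos⇒< 0<1/D refl) ,
      subst (_< e) 4/D≡ 4/D<e
      where
      A A′ : ℚ
      A  = (j ⊖ k) / D
      A′ = (suc (suc j) ⊖ k) / D
      t^D≤ : t ^ D * 2ℚ ^ k ≤ 2ℚ ^ suc (suc j)
      t^D≤ = begin
        t ^ D * 2ℚ ^ k          ≤⟨ *-mono-≤ʳ (<⇒≤ (^-pos k 0<2)) (^-doubling D 0<r (<⇒≤ r<t) [t-r]c≤t) ⟩
        2ℚ * r ^ D * 2ℚ ^ k     ≡⟨ *-assoc 2ℚ (r ^ D) (2ℚ ^ k) ⟩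
        2ℚ * (r ^ D * 2ℚ ^ k)   ≤⟨ *-mono-≤ˡ (<⇒≤ 0<2) (<⇒≤ above) ⟩
        2ℚ * 2ℚ ^ suc j         ∎
        where open ≤-Reasoning
      A′≡ : A′ ≡ (1/D + 1/D) + A
      A′≡ = trans (cong (_/ D) (sym (ℤ.distribʳ-⊖-+-pos 2 j k)))
        (trans (/-homo-+ (+ 2) (j ⊖ k) d) (cong (_+ A) (/-homo-+ (+ 1) (+ 1) d)))
      4/D≡ : + 4 / D ≡ (A′ + 1/D) - (A - 1/D)
      4/D≡ = trans (/-homo-+ (+ 2) (+ 2) d)
        (trans (cong₂ _+_ (/-homo-+ (+ 1) (+ 1) d) (/-homo-+ (+ 1) (+ 1) d))
          (trans (solve 2 (λ o a → (o :+ o) :+ (o :+ o) := (((o :+ o) :+ a) :+ o) :- (a :- o)) refl 1/D A)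
            (cong (λ z → (z + 1/D) - (A - 1/D)) (sym A′≡))))

-- By convention, the fraction of an empty set is 0.
ratio : ℕ → ℕ → ℚ
ratio a zero    = 0ℚ
ratio a (suc d) = + a / suc d

#_ : ∀ {u} {P : Pred (Fin u) 0ℓ} → Decidable P → ℕ
# P? = count P? (allFin _)

-- The universe is Fin u, the value v_i is just i, and ⊥ is nothing.
Answers : ℕ → ℕ → Set
Answers u b = Fin u → Maybe (Fin b)

_≟ₘ_ : ∀ {b} (v w : Maybe (Fin b)) → Dec (v ≡ w)
_≟ₘ_ = Maybe.≡-dec Fin._≟_

-- A set of pairs (x , v x) with x ∈ X is encoded as the partial function
-- sending x ∈ X to just (v x) and x ∉ X to nothing.
record PMap {b} (p : Vector ℝ b) (n u : ℕ) : Set where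
  field
    value       : Answers u b
    keys-size   : # (λ x → ¬? (value x ≟ₘ nothing)) ≡ n
    values-size : ∀ i → fromℕ (# (λ x → value x ≟ₘ just i)) ≃ᵣ p i *ᵣ fromℕ n

DataStructure : (m u b : ℕ) → Set
DataStructure m u b = Vec Bool m → Answers u b

module _ {b} {p : Vector ℝ b} {n u} (M : PMap p n u) (s : Answers u b) where

  open PMap M

  f⁺ : ℚ
  f⁺ = ratio (# (λ x → (value x ≟ₘ nothing) ×-dec ¬? (s x ≟ₘ nothing)))
             (# (λ x → value x ≟ₘ nothing))

  f* : Fin b → ℚ
  f* i = ratio (# (λ x → (value x ≟ₘ just i) ×-dec
                         (¬? (s x ≟ₘ nothing) ×-dec ¬? (s x ≟ₘ just i))))
               (# (λ x → value x ≟ₘ just i))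

  f⁻ : Fin b → ℚ
  f⁻ i = ratio (# (λ x → (value x ≟ₘ just i) ×-dec (s x ≟ₘ nothing)))
               (# (λ x → value x ≟ₘ just i))

  Encodes : (ε⁺ ε* ε⁻ : ℝ) → Set
  Encodes ε⁺ ε* ε⁻ =
    fromℚ f⁺ ≤ᵣ ε⁺ × (∀ i → fromℚ (f* i) ≤ᵣ ε* × fromℚ (f⁻ i) ≤ᵣ ε⁻)

EncodesAll : ∀ {m u b} → DataStructure m u b → (p : Vector ℝ b) (n : ℕ) (ε⁺ ε* ε⁻ : ℝ) → Set
EncodesAll D p n ε⁺ ε* ε⁻ = (M : PMap p n _) → ∃[ s ] Encodes M (D s) ε⁺ ε* ε⁻

entropy : ∀ {b} (p : Vector ℝ b) → (∀ i → 0ᵣ <ᵣ p i) → ℝ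
entropy p p>0 = -ᵣ ∑ (λ i → p i *ᵣ log (p i) (p>0 i))

Admissible : ∀ {b} → Vector ℝ b → ℕ → Set
Admissible p n = 0 ℕ.< n × (∀ i → Σ ℤ λ k → p i *ᵣ fromℕ n ≃ᵣ fromℚ (k / 1))

-- Q n holds for all sufficiently large n satisfying P.
Eventually : (P Q : ℕ → Set) → Set
Eventually P Q = ∃[ N ] (∀ n → N ℕ.≤ n → P n → Q n)

{-# OPTIONS --safe #-}
module Submission where

-- A map with key set X is laid down one key at a time: the j-th key may go to any
-- of at least u − n free positions and must be a position where the string
-- answers the j-th label c_j.  Summing over all placements gives
--   (u − n)^n ≤ Σ_s Π_j a_{c_j}(s),
-- where a_i(s) is the number of positions answered v_i and s ranges over the strings
-- with Σ_i a_i(s) ≤ n + ε⁺ (u − n).  By AM-GM, weighted by n_i = p_i n, each product is at most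
-- Π_j (Σ_i a_i(s)) p_{c_j}, so 1 ≤ 2^m Π_j (ε⁺ + o(1)) p_{c_j}; no factorials,
-- hence no Stirling estimates, are involved.

open import Defs
open ℝ
open RationalLemmas
open import Algebra.Bundles using (CommutativeRing; Monoid)
open import Data.Bool using (Bool; true; false; if_then_else_)
open import Data.Fin as Fin using (Fin; zero; suc)
import Data.Fin.Properties as Fin
open import Data.Integer as ℤ using (ℤ; +_; _⊖_)
import Data.Integer.Properties as ℤ
import Data.Integer.Solver as ℤSolver
open import Data.List using (List; []; _∷_; _++_; length; map; replicate; foldr)
open import Data.Maybe using (Maybe; just; nothing)
open import Data.Nat as ℕ using (ℕ; zero; suc)
import Data.Nat.Properties as ℕ
open import Data.Product using (Σ; ∃-syntax; _×_; _,_; proj₁; proj₂)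
open import Data.Rational
open import Data.Rational.Properties
import Data.Rational.Solver as ℚSolver
open import Data.Rational.Unnormalised as ℚᵘ using (mkℚᵘ)
import Data.Rational.Unnormalised.Properties as ℚᵘ
open import Data.Sum using (inj₁; inj₂)
open import Data.Vec as Vec using (Vec)
import Data.Vec.Properties as Vec
open import Data.Vec.Functional using (updateAt)
open import Data.Vec.Functional.Properties using (updateAt-updates; updateAt-minimal)
open import Function using (_∘_; const; id; Inverse)
open import Level using (0ℓ)
open import Relation.Binary.PropositionalEquality
open import Relation.Nullary using (¬_; Dec; yes; no; does; ¬?; contradiction)
open import Relation.Nullary.Decidable using (dec-true; dec-false; from-yes; _×-dec_)
open import Relation.Unary using (Pred; Decidable)

open import Algebra.Properties.Semiring.Sum ℕ.+-*-semiring
  using (sum; sum-cong-≗; ∑-distrib-+; ∑-comm; *-distribˡ-sum; *-distribʳ-sum; sum-replicate-zero)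
import Algebra.Properties.Semiring.Sum (CommutativeRing.semiring +-*-commutativeRing) as ℚΣ
open import Algebra.Properties.Monoid.Mult ℕ.+-0-monoid using () renaming (_×_ to _×ℕ_)
open import Algebra.Properties.Monoid.Mult +-0-monoid using () renaming (_×_ to _×ℚ_)
open ℚSolver.+-*-Solver using (solve; con; _:+_; _:*_; _:-_; :-_; _:=_)

-- Counting

-- Ordered placements replace a count of maps: each map is then counted once per order in which its
-- keys can be laid down, and the bound for a string becomes a plain product over the label list.
-- The obstacle in the last step is that a point of the cut of a logarithm is only a rational
-- certificate, a power compared with a power of two, and `ε⁺` itself may be irrational. The
-- argument therefore runs on rationals `l < ε⁺ < h < l * t` with `log t ≤ δ`. The encoding
-- hypothesis is used through `h`, the term `log (1 / ε⁺)` through `l`, and the product is bounded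
-- with rate `e = l * t`. The margin `e - h` absorbs the `n` keys, which a string must answer
-- besides its false positives; this is where `n / u → 0` enters. The whole error `δ` is spent on
-- `t`.

module _ {a} {A : Set a} where

  𝟙 : Dec A → ℕ
  𝟙 A? = if does A? then 1 else 0

  𝟙-yes : (A? : Dec A) → A → 𝟙 A? ≡ 1
  𝟙-yes A? x rewrite dec-true A? x = refl

  𝟙-no : (A? : Dec A) → ¬ A → 𝟙 A? ≡ 0
  𝟙-no A? ¬x rewrite dec-false A? ¬x = refl

count-tabulate : ∀ {a} {A : Set a} {P : Pred A 0ℓ} (P? : Decidable P) {n} (g : Fin n → A) →
  Vec.count P? (Vec.tabulate g) ≡ sum (λ i → 𝟙 (P? (g i)))
count-tabulate P? {zero}  g = refl
count-tabulate P? {suc n} g with does (P? (g zero))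
... | true  = cong suc (count-tabulate P? (g ∘ suc))
... | false = count-tabulate P? (g ∘ suc)

#-sum : ∀ {u} {P : Pred (Fin u) 0ℓ} (P? : Decidable P) → # P? ≡ sum (λ x → 𝟙 (P? x))
#-sum P? = count-tabulate P? id

sum-mono-≤ : ∀ {n} {f g : Fin n → ℕ} → (∀ i → f i ℕ.≤ g i) → sum f ℕ.≤ sum g
sum-mono-≤ {zero}  f≤g = ℕ.z≤n
sum-mono-≤ {suc n} f≤g = ℕ.+-mono-≤ (f≤g zero) (sum-mono-≤ (f≤g ∘ suc))

term≤sum : ∀ {n} (f : Fin n → ℕ) i → f i ℕ.≤ sum f
term≤sum {suc n} f zero    = ℕ.m≤m+n (f zero) _
term≤sum {suc n} f (suc i) = ℕ.≤-trans (term≤sum (f ∘ suc) i) (ℕ.m≤n+m _ (f zero))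

sum-0 : ∀ {n} {f : Fin n → ℕ} → (∀ i → f i ≡ 0) → sum f ≡ 0
sum-0 {n} f≡0 = trans (sum-cong-≗ f≡0) (sum-replicate-zero n)

sum-const : ∀ n k → sum {n} (const k) ≡ n ℕ.* k
sum-const zero    k = refl
sum-const (suc n) k = cong (k ℕ.+_) (sum-const n k)

#-pos : ∀ {u} {P : Pred (Fin u) 0ℓ} (P? : Decidable P) {x} → P x → 1 ℕ.≤ # P?
#-pos P? {x} Px = ℕ.≤-trans (ℕ.≤-reflexive (sym (𝟙-yes (P? x) Px)))
  (ℕ.≤-trans (term≤sum _ x) (ℕ.≤-reflexive (sym (#-sum P?))))

sum-updateAt : ∀ {a} {A : Set a} (h : A → ℕ) {n} (f : Fin n → A) x a →
  sum (h ∘ updateAt f x (const a)) ℕ.+ h (f x) ≡ sum (h ∘ f) ℕ.+ h a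
sum-updateAt h {suc n} f zero a = begin
  h a ℕ.+ sum (h ∘ f ∘ suc) ℕ.+ h (f zero) ≡⟨ ℕ.+-comm _ (h (f zero)) ⟩
  h (f zero) ℕ.+ (h a ℕ.+ sum (h ∘ f ∘ suc)) ≡⟨ cong (h (f zero) ℕ.+_) (ℕ.+-comm (h a) _) ⟩
  h (f zero) ℕ.+ (sum (h ∘ f ∘ suc) ℕ.+ h a) ≡⟨ ℕ.+-assoc (h (f zero)) _ (h a) ⟨
  h (f zero) ℕ.+ sum (h ∘ f ∘ suc) ℕ.+ h a ∎
  where open ≡-Reasoning
sum-updateAt h {suc n} f (suc x) a = begin
  h (f zero) ℕ.+ sum (h ∘ updateAt (f ∘ suc) x (const a)) ℕ.+ h (f (suc x)) ≡⟨ ℕ.+-assoc (h (f zero)) _ _ ⟩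
  h (f zero) ℕ.+ (sum (h ∘ updateAt (f ∘ suc) x (const a)) ℕ.+ h (f (suc x)))
    ≡⟨ cong (h (f zero) ℕ.+_) (sum-updateAt h (f ∘ suc) x a) ⟩
  h (f zero) ℕ.+ (sum (h ∘ f ∘ suc) ℕ.+ h a) ≡⟨ ℕ.+-assoc (h (f zero)) _ (h a) ⟨
  h (f zero) ℕ.+ sum (h ∘ f ∘ suc) ℕ.+ h a ∎
  where open ≡-Reasoning

-- Placing the keys of a map one at a time

labels : ∀ {b} → (Fin b → ℕ) → List (Fin b)
labels {zero}  k = []
labels {suc b} k = replicate (k zero) zero ++ map suc (labels (k ∘ suc))

∏ : ∀ {b} → List (Fin b) → (Fin b → ℕ) → ℕ
∏ cs g = foldr (λ c → g c ℕ.*_) 1 cs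

-- A derivation is an ordered placement: the labels come in the fixed order of the list, the
-- positions are free choices. Demanding an undefined position keeps the keys distinct.
data Grow {u b} : Answers u b → List (Fin b) → Answers u b → Set where
  done : ∀ {f} → Grow f [] f
  step : ∀ {f c cs f′} x → f x ≡ nothing →
         Grow (updateAt f x (const (just c))) cs f′ → Grow f (c ∷ cs) f′

Grow-preserves : ∀ {u b} {f f′ : Answers u b} {cs} → Grow f cs f′ →
  ∀ {x c} → f x ≡ just c → f′ x ≡ just c
Grow-preserves done eq = eq
Grow-preserves {f = f} (step x fx≡∅ g) {y} {c} eq = Grow-preserves g
  (trans (updateAt-minimal y x f (λ { refl → just≢nothing (trans (sym eq) fx≡∅) })) eq)
  where
  just≢nothing : ¬ just c ≡ nothing
  just≢nothing ()

-- Each step trades one `h nothing` for one `h (just c)`. The weight `h` is arbitrary so that a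
-- single invariant yields the number of keys, the size of each class and the number of free
-- positions. Both sides are sums, which avoids truncated subtraction.
sum-Grow : ∀ {u b} (h : Maybe (Fin b) → ℕ) {f f′ : Answers u b} {cs} → Grow f cs f′ →
  sum (h ∘ f′) ℕ.+ length cs ℕ.* h nothing ≡ sum (h ∘ f) ℕ.+ foldr (λ c → h (just c) ℕ.+_) 0 cs
sum-Grow h done = refl
sum-Grow h {f} {f′} {c ∷ cs} (step x fx≡∅ g) = begin
  s′ ℕ.+ (h∅ ℕ.+ k)         ≡⟨ cong (s′ ℕ.+_) (ℕ.+-comm h∅ k) ⟩
  s′ ℕ.+ (k ℕ.+ h∅)         ≡⟨ ℕ.+-assoc s′ k h∅ ⟨
  s′ ℕ.+ k ℕ.+ h∅           ≡⟨ cong (ℕ._+ h∅) (sum-Grow h g) ⟩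
  s₁ ℕ.+ r ℕ.+ h∅           ≡⟨ ℕ.+-assoc s₁ r h∅ ⟩
  s₁ ℕ.+ (r ℕ.+ h∅)         ≡⟨ cong (s₁ ℕ.+_) (ℕ.+-comm r h∅) ⟩
  s₁ ℕ.+ (h∅ ℕ.+ r)         ≡⟨ ℕ.+-assoc s₁ h∅ r ⟨
  s₁ ℕ.+ h∅ ℕ.+ r           ≡⟨ cong (λ v → s₁ ℕ.+ h v ℕ.+ r) fx≡∅ ⟨
  s₁ ℕ.+ h (f x) ℕ.+ r      ≡⟨ cong (ℕ._+ r) (sum-updateAt h f x (just c)) ⟩
  s ℕ.+ h (just c) ℕ.+ r    ≡⟨ ℕ.+-assoc s _ r ⟩
  s ℕ.+ (h (just c) ℕ.+ r)  ∎
  where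
  open ≡-Reasoning
  h∅ k s s′ s₁ r : ℕ
  h∅ = h nothing
  k = length cs ℕ.* h nothing
  s = sum (h ∘ f)
  s′ = sum (h ∘ f′)
  s₁ = sum (h ∘ updateAt f x (const (just c)))
  r = foldr (λ c → h (just c) ℕ.+_) 0 cs

Agree : ∀ {u b} → Answers u b → Answers u b → Set
Agree f s = ∀ {x c} → f x ≡ just c → s x ≡ just c

undefinedAt : ∀ {b} → Maybe (Fin b) → ℕ
undefinedAt v = 𝟙 (v ≟ₘ nothing)

module _ {N u b} (D : Fin N → Answers u b) where

  hits : Fin N → Fin b → ℕ
  hits σ c = sum (λ x → 𝟙 (D σ x ≟ₘ just c))

  -- Each key of the map is placed in one of at least B free positions; the
  -- weight w keeps track of the strings compatible with the keys placed so far.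
  growth-bound : ∀ B cs (f : Answers u b) (w : Fin N → ℕ) →
    B ℕ.+ length cs ℕ.≤ sum (undefinedAt ∘ f) →
    (∀ {f′} → Grow f cs f′ → ∃[ σ ] (1 ℕ.≤ w σ × Agree f′ (D σ))) →
    B ℕ.^ length cs ℕ.≤ sum (λ σ → w σ ℕ.* ∏ cs (hits σ))
  growth-bound B [] f w _ encode =
    let (σ , 1≤w , _) = encode done
    in ℕ.≤-trans 1≤w (ℕ.≤-trans (ℕ.≤-reflexive (sym (ℕ.*-identityʳ (w σ))))
         (term≤sum (λ σ → w σ ℕ.* 1) σ))
  growth-bound B (c ∷ cs) f w room encode = begin
    B ℕ.* B ℕ.^ k
      -- The room kept for the keys still to come guarantees that at least `B` positions are free at
      -- every stage.
      ≤⟨ ℕ.*-monoˡ-≤ (B ℕ.^ k) (ℕ.≤-trans (ℕ.m≤m+n B (suc k)) room) ⟩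
    sum (undefinedAt ∘ f) ℕ.* B ℕ.^ k
      ≡⟨ *-distribʳ-sum (B ℕ.^ k) (undefinedAt ∘ f) ⟩
    sum (λ x → undefinedAt (f x) ℕ.* B ℕ.^ k)
      ≤⟨ sum-mono-≤ placed ⟩
    sum (λ x → sum (λ σ → w σ ℕ.* 𝟙 (D σ x ≟ₘ just c) ℕ.* W σ))
      -- For a fixed string the remaining product `W σ` does not depend on `x`, so after the
      -- exchange the choices of `x` factor out as `hits σ c`.
      ≡⟨ ∑-comm (λ x σ → w σ ℕ.* 𝟙 (D σ x ≟ₘ just c) ℕ.* W σ) ⟩
    sum (λ σ → sum (λ x → w σ ℕ.* 𝟙 (D σ x ≟ₘ just c) ℕ.* W σ))
      ≡⟨ sum-cong-≗ (λ σ → factor (w σ) (W σ) (λ x → 𝟙 (D σ x ≟ₘ just c))) ⟩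
    sum (λ σ → w σ ℕ.* (hits σ c ℕ.* W σ)) ∎
    where
    open ℕ.≤-Reasoning
    k : ℕ
    k = length cs
    W : Fin N → ℕ
    W σ = ∏ cs (hits σ)
    factor : ∀ y z {n} (g : Fin n → ℕ) → sum (λ x → y ℕ.* g x ℕ.* z) ≡ y ℕ.* (sum g ℕ.* z)
    factor y z g = trans (sym (*-distribʳ-sum z (λ x → y ℕ.* g x)))
      (trans (cong (ℕ._* z) (sym (*-distribˡ-sum y g))) (ℕ.*-assoc y (sum g) z))
    placed : ∀ x → undefinedAt (f x) ℕ.* B ℕ.^ k ℕ.≤ sum (λ σ → w σ ℕ.* 𝟙 (D σ x ≟ₘ just c) ℕ.* W σ)
    placed x with f x in fx≡
    ... | just _  = ℕ.z≤n
    ... | nothing = ℕ.≤-trans (ℕ.≤-reflexive (ℕ.*-identityˡ (B ℕ.^ k)))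
      -- Strings not answering `c` at `x` lose their weight. The string encoding the completed map
      -- keeps its own, since later placements never overwrite `x`.
      (growth-bound B cs f₁ (λ σ → w σ ℕ.* 𝟙 (D σ x ≟ₘ just c)) room₁ λ g →
        let (σ , 1≤w , agree) = encode (step x fx≡ g)
            σx≡c = agree (Grow-preserves g (updateAt-updates x f))
        in σ , ℕ.≤-trans 1≤w (ℕ.≤-reflexive (sym (trans
                 (cong (w σ ℕ.*_) (𝟙-yes (D σ x ≟ₘ just c) σx≡c)) (ℕ.*-identityʳ (w σ))))) , agree)
      where
      f₁ : Answers u b
      f₁ = updateAt f x (const (just c))
      free₁ : sum (undefinedAt ∘ f₁) ℕ.+ 1 ≡ sum (undefinedAt ∘ f)
      free₁ = trans (cong (λ v → sum (undefinedAt ∘ f₁) ℕ.+ undefinedAt v) (sym fx≡))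
        (trans (sum-updateAt undefinedAt f x (just c)) (ℕ.+-identityʳ _))
      room₁ : B ℕ.+ k ℕ.≤ sum (undefinedAt ∘ f₁)
      room₁ = ℕ.+-cancelʳ-≤ 1 _ _ (ℕ.≤-trans (ℕ.≤-reflexive (trans (ℕ.+-assoc B k 1) (cong (B ℕ.+_) (ℕ.+-comm k 1))))
        (ℕ.≤-trans room (ℕ.≤-reflexive (sym free₁))))

𝟙-cong : ∀ {a b} {A : Set a} {B : Set b} (A? : Dec A) (B? : Dec B) →
  (A → B) → (B → A) → 𝟙 A? ≡ 𝟙 B?
𝟙-cong A? (yes b) _   b⇒a = 𝟙-yes A? (b⇒a b)
𝟙-cong A? (no ¬b) a⇒b _   = 𝟙-no A? (¬b ∘ a⇒b)

sum-δ : ∀ {b} (g : Fin b → ℕ) c → sum (λ i → g i ℕ.* 𝟙 (just i ≟ₘ just c)) ≡ g c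
sum-δ {suc b} g zero = trans (cong₂ ℕ._+_ (ℕ.*-identityʳ (g zero))
    (sum-0 {b} (λ i → ℕ.*-zeroʳ (g (suc i))))) (ℕ.+-identityʳ (g zero))
sum-δ {suc b} g (suc c) = trans (cong₂ ℕ._+_ (ℕ.*-zeroʳ (g zero)) (sum-cong-≗ {b} (λ i →
    cong (g (suc i) ℕ.*_) (𝟙-cong (just (suc i) ≟ₘ just (suc c)) (just i ≟ₘ just c)
      (λ { refl → refl }) (λ { refl → refl })))))
  (sum-δ (g ∘ suc) c)

-- Folds over the label list

module _ {c ℓ} (M : Monoid c ℓ) where

  open Monoid M renaming (refl to ≈-refl; sym to ≈-sym; trans to ≈-trans)
  open import Algebra.Properties.Monoid.Mult M using () renaming (_×_ to _·_)
  import Algebra.Properties.Monoid.Sum M as M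

  fold-++ : ∀ {a} {A : Set a} (g : A → Carrier) xs ys →
    foldr (λ x → g x ∙_) ε (xs ++ ys) ≈ foldr (λ x → g x ∙_) ε xs ∙ foldr (λ x → g x ∙_) ε ys
  fold-++ g []       ys = ≈-sym (identityˡ _)
  fold-++ g (x ∷ xs) ys = ≈-trans (∙-congˡ (fold-++ g xs ys)) (≈-sym (assoc _ _ _))

  fold-replicate : ∀ {a} {A : Set a} (g : A → Carrier) k x →
    foldr (λ x → g x ∙_) ε (replicate k x) ≈ k · g x
  fold-replicate g zero    x = ≈-refl
  fold-replicate g (suc k) x = ∙-congˡ (fold-replicate g k x)

  fold-map : ∀ {a b} {A : Set a} {B : Set b} (g : B → Carrier) (f : A → B) xs →
    foldr (λ x → g x ∙_) ε (map f xs) ≈ foldr (λ x → g (f x) ∙_) ε xs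
  fold-map g f []       = ≈-refl
  fold-map g f (x ∷ xs) = ∙-congˡ (fold-map g f xs)

  -- Stated for any monoid because it serves addition both on `ℕ`, for lengths and occurrences, and
  -- on `ℚ`, for the sums in AM-GM and in the exponents.
  fold-labels : ∀ {b} (k : Fin b → ℕ) (g : Fin b → Carrier) →
    foldr (λ x → g x ∙_) ε (labels k) ≈ M.sum (λ i → k i · g i)
  fold-labels {zero}  k g = ≈-refl
  fold-labels {suc b} k g = ≈-trans (fold-++ g (replicate (k zero) zero) _)
    (∙-cong (fold-replicate g (k zero) zero)
      (≈-trans (fold-map g suc (labels (k ∘ suc))) (fold-labels (k ∘ suc) (g ∘ suc))))

×≡* : ∀ k x → k ×ℕ x ≡ k ℕ.* x
×≡* zero    x = refl
×≡* (suc k) x = cong (x ℕ.+_) (×≡* k x)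

length-labels : ∀ {b} (k : Fin b → ℕ) → length (labels k) ≡ sum k
length-labels k = trans (fold-labels ℕ.+-0-monoid k (const 1))
  (sum-cong-≗ (λ i → trans (×≡* (k i) 1) (ℕ.*-identityʳ (k i))))

occurrences-labels : ∀ {b} (k : Fin b → ℕ) i →
  foldr (λ c → 𝟙 (just c ≟ₘ just i) ℕ.+_) 0 (labels k) ≡ k i
occurrences-labels k i = trans (fold-labels ℕ.+-0-monoid k (λ c → 𝟙 (just c ≟ₘ just i)))
  (trans (sum-cong-≗ (λ j → ×≡* (k j) _)) (sum-δ k i))

-- Indexing strings by `Fin (2 ^ m)` turns sums over strings into finite sums. A surjective
-- enumeration suffices, as a repeated string could only enlarge an upper bound.
bits : ∀ {m} → Fin (2 ℕ.^ m) → Vec Bool m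
bits i = Vec.tabulate (λ j → Inverse.to Fin.2↔Bool (Fin.finToFun i j))

bits-surjective : ∀ {m} (s : Vec Bool m) → ∃[ i ] bits i ≡ s
bits-surjective s = Fin.funToFin digits ,
  trans (Vec.tabulate-cong (λ j → trans (cong (Inverse.to Fin.2↔Bool) (Fin.finToFun-funToFin digits j))
          (Inverse.strictlyInverseˡ Fin.2↔Bool (Vec.lookup s j))))
    (Vec.tabulate∘lookup s)
  where
  digits : Fin _ → Fin 2
  digits j = Inverse.from Fin.2↔Bool (Vec.lookup s j)

-- Rational arithmetic

0<1 : 0ℚ < 1ℚ
0<1 = from-yes (0ℚ <? 1ℚ)

<⇒≱ : ∀ {p q} → p < q → ¬ q ≤ p
<⇒≱ p<q q≤p = <-irrefl refl (<-≤-trans p<q q≤p)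

nat-+ : ∀ m n → nat (m ℕ.+ n) ≡ nat m + nat n
nat-+ zero    n = sym (+-identityˡ (nat n))
nat-+ (suc m) n = trans (cong (λ z → 1ℚ + z) (nat-+ m n)) (sym (+-assoc 1ℚ (nat m) (nat n)))

nat-* : ∀ m n → nat (m ℕ.* n) ≡ nat m * nat n
nat-* zero    n = sym (*-zeroˡ (nat n))
nat-* (suc m) n = trans (nat-+ n (m ℕ.* n)) (trans (cong (λ z → nat n + z) (nat-* m n))
  (solve 2 (λ x y → y :+ x :* y := (con 1ℚ :+ x) :* y) refl (nat m) (nat n)))

nat-^ : ∀ m n → nat (m ℕ.^ n) ≡ nat m ^ n
nat-^ m zero    = refl
nat-^ m (suc n) = trans (nat-* m (m ℕ.^ n)) (cong (nat m *_) (nat-^ m n))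

nat-mono-≤ : ∀ {m n} → m ℕ.≤ n → nat m ≤ nat n
nat-mono-≤ {n = n} ℕ.z≤n = 0≤nat n
nat-mono-≤ (ℕ.s≤s m≤n)   = +-monoʳ-≤ 1ℚ (nat-mono-≤ m≤n)

nat-mono-< : ∀ {m n} → m ℕ.< n → nat m < nat n
nat-mono-< {m} m<n = <-≤-trans (add-pos⇒< 0<1 (+-comm (nat m) 1ℚ)) (nat-mono-≤ m<n)

0<nat : ∀ {n} → 0 ℕ.< n → 0ℚ < nat n
0<nat = nat-mono-<

nat-injective : ∀ {m n} → nat m ≡ nat n → m ≡ n
nat-injective eq = ℕ.≤-antisym (ℕ.≮⇒≥ λ n<m → <-irrefl (sym eq) (nat-mono-< n<m))
                               (ℕ.≮⇒≥ λ m<n → <-irrefl eq (nat-mono-< m<n))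

nat≡/1 : ∀ n → nat n ≡ + n / 1
nat≡/1 zero    = refl
nat≡/1 (suc n) = trans (cong (λ z → 1ℚ + z) (nat≡/1 n)) (sym (/-homo-+ (+ 1) (+ n) 0))

/*nat : ∀ (z : ℤ) d → z / suc d * nat (suc d) ≡ z / 1
/*nat z d = trans (cong (z / suc d *_) (nat≡/1 (suc d))) (toℚᵘ-injective (begin
  toℚᵘ (z / suc d * (+ suc d / 1))
    ≈⟨ toℚᵘ-homo-* (z / suc d) (+ suc d / 1) ⟩
  toℚᵘ (z / suc d) ℚᵘ.* toℚᵘ (+ suc d / 1)
    ≈⟨ ℚᵘ.*-cong (toℚᵘ-fromℚᵘ (mkℚᵘ z d)) (toℚᵘ-fromℚᵘ (mkℚᵘ (+ suc d) 0)) ⟩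
  mkℚᵘ z d ℚᵘ.* mkℚᵘ (+ suc d) 0
    ≈⟨ ℚᵘ.*≡* (ℤS.solve 2 (λ z D → z ℤS.:* D ℤS.:* ℤS.con (+ 1) ℤS.:= z ℤS.:* (D ℤS.:* ℤS.con (+ 1))) refl z (+ suc d)) ⟩
  mkℚᵘ z 0
    ≈⟨ toℚᵘ-fromℚᵘ (mkℚᵘ z 0) ⟨
  toℚᵘ (z / 1) ∎))
  where
  open import Relation.Binary.Reasoning.Setoid ℚᵘ.≃-setoid
  module ℤS = ℤSolver.+-*-Solver

ratio*nat : ∀ a {d} → 0 ℕ.< d → ratio a d * nat d ≡ nat a
ratio*nat a {suc d} _ = trans (/*nat (+ a) d) (sym (nat≡/1 a))

⊖/*nat : ∀ j k d → (j ⊖ k) / suc d * nat (suc d) + nat k ≡ nat j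
⊖/*nat j k d = begin
  (j ⊖ k) / suc d * nat (suc d) + nat k ≡⟨ cong₂ _+_ (/*nat (j ⊖ k) d) (nat≡/1 k) ⟩
  (j ⊖ k) / 1 + + k / 1                 ≡⟨ /-homo-+ (j ⊖ k) (+ k) 0 ⟨
  ((j ⊖ k) ℤ.+ + k) / 1                 ≡⟨ cong (λ z → (z ℤ.+ + k) / 1) (ℤ.m-n≡m⊖n j k) ⟨
  ((+ j ℤ.- + k) ℤ.+ + k) / 1           ≡⟨ cong (_/ 1) (ℤS.solve 2 (λ a b → (a ℤS.:- b) ℤS.:+ b ℤS.:= a) refl (+ j) (+ k)) ⟩
  + j / 1                               ≡⟨ nat≡/1 j ⟨
  nat j                                 ∎
  where
  open ≡-Reasoning
  module ℤS = ℤSolver.+-*-Solver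

*-cancelʳ-≤′ : ∀ {r p q} → 0ℚ < r → p * r ≤ q * r → p ≤ q
*-cancelʳ-≤′ {r} 0<r = *-cancelʳ-≤-pos r {{positive 0<r}}

*-cancelʳ-<′ : ∀ {r p q} → 0ℚ < r → p * r < q * r → p < q
*-cancelʳ-<′ {r} 0<r = *-cancelʳ-<-nonNeg r {{nonNegative (<⇒≤ 0<r)}}

*-mono-≤-nonNeg : ∀ {p q r s} → 0ℚ ≤ p → 0ℚ ≤ s → p ≤ q → r ≤ s → p * r ≤ q * s
*-mono-≤-nonNeg 0≤p 0≤s p≤q r≤s = ≤-trans (*-mono-≤ˡ 0≤p r≤s) (*-mono-≤ʳ 0≤s p≤q)

2^-cancel-≤ : ∀ {m n} → 2ℚ ^ m ≤ 2ℚ ^ n → m ℕ.≤ n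
2^-cancel-≤ {m} {n} le = ℕ.≮⇒≥ λ n<m → <⇒≱ (<-≤-trans 2^n<2^1+n (2^-mono-≤ n<m)) le
  where
  2^n<2^1+n : 2ℚ ^ n < 2ℚ ^ suc n
  2^n<2^1+n = add-pos⇒< (^-pos n 0<2) (solve 1 (λ y → y :+ y := con 2ℚ :* y) refl (2ℚ ^ n))

-- Cuts are open and supply only strict comparisons; density of `ℚ` turns these into inequalities at
-- the end points.
≤-from-< : ∀ {p q} → (∀ {r} → r < p → r ≤ q) → p ≤ q
≤-from-< below = ≮⇒≥ λ q<p → let (r , q<r , r<p) = <-dense q<p in <⇒≱ q<r (below r<p)

≤-from-> : ∀ {p q} → (∀ {r} → q < r → p ≤ r) → p ≤ q
≤-from-> above = ≮⇒≥ λ q<p → let (r , q<r , r<p) = <-dense q<p in <⇒≱ r<p (above q<r)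

-- Products over lists and the AM-GM inequality

module _ {a} {A : Set a} where

  ∑ℓ ∏ℓ : List A → (A → ℚ) → ℚ
  ∑ℓ xs g = foldr (λ x s → g x + s) 0ℚ xs
  ∏ℓ xs g = foldr (λ x → g x *_) 1ℚ xs

  ∏ℓ-pos : ∀ xs {g} → (∀ x → 0ℚ < g x) → 0ℚ < ∏ℓ xs g
  ∏ℓ-pos []       0<g = 0<1
  ∏ℓ-pos (x ∷ xs) 0<g = 0<* (0<g x) (∏ℓ-pos xs 0<g)

  ∏ℓ-nonNeg : ∀ xs {g} → (∀ x → 0ℚ ≤ g x) → 0ℚ ≤ ∏ℓ xs g
  ∏ℓ-nonNeg []       0≤g = <⇒≤ 0<1
  ∏ℓ-nonNeg (x ∷ xs) 0≤g = 0≤* (0≤g x) (∏ℓ-nonNeg xs 0≤g)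

  ∏ℓ-cong : ∀ xs {g h : A → ℚ} → (∀ x → g x ≡ h x) → ∏ℓ xs g ≡ ∏ℓ xs h
  ∏ℓ-cong []       eq = refl
  ∏ℓ-cong (x ∷ xs) eq = cong₂ _*_ (eq x) (∏ℓ-cong xs eq)

  ∏ℓ-distrib-* : ∀ xs (g h : A → ℚ) → ∏ℓ xs (λ x → g x * h x) ≡ ∏ℓ xs g * ∏ℓ xs h
  ∏ℓ-distrib-* []       g h = refl
  ∏ℓ-distrib-* (x ∷ xs) g h = trans (cong (g x * h x *_) (∏ℓ-distrib-* xs g h))
    (solve 4 (λ a b c d → a :* b :* (c :* d) := a :* c :* (b :* d)) refl (g x) (h x) (∏ℓ xs g) (∏ℓ xs h))

  ∏ℓ-const : ∀ xs y → ∏ℓ xs (const y) ≡ y ^ length xs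
  ∏ℓ-const []       y = refl
  ∏ℓ-const (x ∷ xs) y = cong (y *_) (∏ℓ-const xs y)

  ∏ℓ-*ˡ : ∀ xs y (g : A → ℚ) → ∏ℓ xs (λ x → y * g x) ≡ y ^ length xs * ∏ℓ xs g
  ∏ℓ-*ˡ xs y g = trans (∏ℓ-distrib-* xs (const y) g) (cong (_* ∏ℓ xs g) (∏ℓ-const xs y))

square-nonNeg : ∀ x → 0ℚ ≤ x * x
square-nonNeg x with ≤-total 0ℚ x
... | inj₁ 0≤x = 0≤* 0≤x 0≤x
... | inj₂ x≤0 = subst (0ℚ ≤_) (solve 1 (λ x → :- x :* :- x := x :* x) refl x)
  (0≤* (neg-antimono-≤ x≤0) (neg-antimono-≤ x≤0))

-- The graph of y ↦ y ^ (1 + k) lies above its tangent line at z.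
tangent : ∀ {y z} k → 0ℚ ≤ y → 0ℚ ≤ z → (nat (suc k) * y - nat k * z) * z ^ k ≤ y ^ suc k
tangent {y} {z} zero 0≤y 0≤z = ≤-reflexive
  (solve 2 (λ y z → ((con 1ℚ :+ con 0ℚ) :* y :- con 0ℚ :* z) :* con 1ℚ := y :* con 1ℚ) refl y z)
-- The slack for `suc k` is `nat (suc k) * z ^ k * (y - z) ^ 2` plus `y` times the slack for `k`.
tangent {y} {z} (suc k) 0≤y 0≤z = add-nonNeg⇒≤
  (0≤+ (0≤* (0≤* (<⇒≤ (0<nat-suc k)) (^-nonNeg k)) (square-nonNeg (y - z)))
       (0≤* 0≤y (≤⇒0≤- (tangent k 0≤y 0≤z))))
  (solve 5 (λ y z n Z Y →
      ((con 1ℚ :+ (con 1ℚ :+ n)) :* y :- (con 1ℚ :+ n) :* z) :* (z :* Z)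
        :+ ((con 1ℚ :+ n) :* Z :* ((y :- z) :* (y :- z)) :+ y :* (Y :- ((con 1ℚ :+ n) :* y :- n :* z) :* Z))
        := y :* Y) refl y z (nat k) (z ^ k) (y ^ suc k))
  where
  ^-nonNeg : ∀ k → 0ℚ ≤ z ^ k
  ^-nonNeg zero    = <⇒≤ 0<1
  ^-nonNeg (suc k) = 0≤* 0≤z (^-nonNeg k)

∑ℓ-nonNeg : ∀ {a} {A : Set a} xs {g : A → ℚ} → (∀ x → 0ℚ ≤ g x) → 0ℚ ≤ ∑ℓ xs g
∑ℓ-nonNeg []       0≤g = ≤-refl
∑ℓ-nonNeg (x ∷ xs) 0≤g = 0≤+ (0≤g x) (∑ℓ-nonNeg xs 0≤g)

-- A form without roots. With `z` the mean of a tail of length `k`, the head is at most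
-- `(k + 1) * y - k * z`, the tail product is at most `z ^ k` by induction, and the tangent at `z`
-- bounds the product of the two by `y ^ (k + 1)`.
am-gm : ∀ {a} {A : Set a} xs {g : A → ℚ} {y} → (∀ x → 0ℚ ≤ g x) → 0ℚ ≤ y →
  ∑ℓ xs g ≤ nat (length xs) * y → ∏ℓ xs g ≤ y ^ length xs
am-gm [] 0≤g 0≤y le = ≤-refl
am-gm (x ∷ []) {g} {y} 0≤g 0≤y le = begin
  g x * 1ℚ         ≡⟨ solve 1 (λ g → g :* con 1ℚ := g :+ con 0ℚ) refl (g x) ⟩
  g x + 0ℚ         ≤⟨ le ⟩
  (1ℚ + 0ℚ) * y    ≡⟨ solve 1 (λ y → (con 1ℚ :+ con 0ℚ) :* y := y :* con 1ℚ) refl y ⟩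
  y * 1ℚ           ∎
  where open ≤-Reasoning
am-gm (x ∷ xs@(_ ∷ xs′)) {g} {y} 0≤g 0≤y le = begin
  g x * ∏ℓ xs g                            ≤⟨ *-mono-≤ˡ (0≤g x) (am-gm xs 0≤g 0≤z (≤-reflexive (sym kz≡S))) ⟩
  g x * z ^ k                              ≤⟨ *-mono-≤ʳ 0≤z^k gx≤ ⟩
  (nat (suc k) * y - nat k * z) * z ^ k    ≤⟨ tangent k 0≤y 0≤z ⟩
  y ^ suc k                                ∎
  where
  open ≤-Reasoning
  k : ℕ
  k = length xs
  S z : ℚ
  S = ∑ℓ xs g
  z = S * ratio 1 k
  kz≡S : nat k * z ≡ S
  kz≡S = trans (solve 3 (λ n s r → n :* (s :* r) := s :* (r :* n)) refl (nat k) S (ratio 1 k))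
    (trans (cong (S *_) (ratio*nat 1 {k} (ℕ.s≤s ℕ.z≤n))) (solve 1 (λ s → s :* con (1ℚ + 0ℚ) := s) refl S))
  0≤z : 0ℚ ≤ z
  0≤z = *-cancelʳ-≤′ (0<nat-suc (length xs′)) (≤-trans (≤-reflexive (*-zeroˡ (nat k)))
    (≤-trans (∑ℓ-nonNeg xs 0≤g) (≤-reflexive (trans (sym kz≡S) (*-comm (nat k) z)))))
  0≤z^k : 0ℚ ≤ z ^ k
  0≤z^k = subst (0ℚ ≤_) (∏ℓ-const xs z) (∏ℓ-nonNeg xs (const 0≤z))
  gx≤ : g x ≤ nat (suc k) * y - nat k * z
  gx≤ = begin
    g x                              ≡⟨ solve 2 (λ g s → g := g :+ s :- s) refl (g x) S ⟩
    g x + S - S                      ≤⟨ +-monoˡ-≤ (- S) le ⟩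
    nat (suc k) * y - S              ≡⟨ cong (λ s → nat (suc k) * y - s) kz≡S ⟨
    nat (suc k) * y - nat k * z      ∎

-- Rational certificates for logarithms

1^ : ∀ n → 1ℚ ^ n ≡ 1ℚ
1^ zero    = refl
1^ (suc n) = trans (*-identityˡ (1ℚ ^ n)) (1^ n)

-- A rational certificate for log x ≤ q, namely x ^ (1 + d) ≤ 2 ^ (j - k) with (j - k) / (1 + d) ≤ q.
record LogBound (x q : ℚ) : Set where
  constructor logBound
  field
    d j k     : ℕ
    power     : x ^ suc d * 2ℚ ^ k ≤ 2ℚ ^ j
    exponents : nat j ≤ q * nat (suc d) + nat k

logBound-1 : LogBound 1ℚ 0ℚ
logBound-1 = logBound 0 0 0 ≤-refl ≤-refl

-- This stands in for `log (x * y) = log x + log y`: each power inequality is raised to the other's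
-- denominator, which gives both the exponent `D * D′`, and the two are multiplied.
logBound-* : ∀ {x y q r} → 0ℚ < x → 0ℚ < y → LogBound x q → LogBound y r → LogBound (x * y) (q + r)
logBound-* {x} {y} {q} {r} 0<x 0<y (logBound d j k x≤ j≤) (logBound d′ j′ k′ y≤ j′≤) =
  logBound (d′ ℕ.+ d ℕ.* D′) (j ℕ.* D′ ℕ.+ j′ ℕ.* D) (k ℕ.* D′ ℕ.+ k′ ℕ.* D) xy≤ exponents
  where
  open ≤-Reasoning
  D D′ : ℕ
  D  = suc d
  D′ = suc d′
  split : ∀ m n → 2ℚ ^ (m ℕ.* D′ ℕ.+ n ℕ.* D) ≡ (2ℚ ^ m) ^ D′ * (2ℚ ^ n) ^ D
  split m n = trans (^-homo-* 2ℚ (m ℕ.* D′) (n ℕ.* D))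
    (sym (cong₂ _*_ (^-assocʳ 2ℚ m D′) (^-assocʳ 2ℚ n D)))
  nat-split : ∀ m n → nat (m ℕ.* D′ ℕ.+ n ℕ.* D) ≡ nat m * nat D′ + nat n * nat D
  nat-split m n = trans (nat-+ (m ℕ.* D′) (n ℕ.* D)) (cong₂ _+_ (nat-* m D′) (nat-* n D))
  X Y : ℚ
  X = x ^ D * 2ℚ ^ k
  Y = y ^ D′ * 2ℚ ^ k′
  0<X : 0ℚ < X
  0<X = 0<* (^-pos D 0<x) (^-pos k 0<2)
  0<Y : 0ℚ < Y
  0<Y = 0<* (^-pos D′ 0<y) (^-pos k′ 0<2)
  xy≤ : (x * y) ^ (D ℕ.* D′) * 2ℚ ^ (k ℕ.* D′ ℕ.+ k′ ℕ.* D) ≤ 2ℚ ^ (j ℕ.* D′ ℕ.+ j′ ℕ.* D)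
  xy≤ = begin
    (x * y) ^ (D ℕ.* D′) * 2ℚ ^ (k ℕ.* D′ ℕ.+ k′ ℕ.* D)
      ≡⟨ cong₂ _*_ (^-distrib-* x y (D ℕ.* D′)) (split k k′) ⟩
    x ^ (D ℕ.* D′) * y ^ (D ℕ.* D′) * ((2ℚ ^ k) ^ D′ * (2ℚ ^ k′) ^ D)
      ≡⟨ cong₂ (λ s t → s * t * ((2ℚ ^ k) ^ D′ * (2ℚ ^ k′) ^ D))
           (sym (^-assocʳ x D D′)) (trans (cong (y ^_) (ℕ.*-comm D D′)) (sym (^-assocʳ y D′ D))) ⟩
    (x ^ D) ^ D′ * (y ^ D′) ^ D * ((2ℚ ^ k) ^ D′ * (2ℚ ^ k′) ^ D)
      ≡⟨ solve 4 (λ a b c d → a :* b :* (c :* d) := a :* c :* (b :* d)) refl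
           ((x ^ D) ^ D′) ((y ^ D′) ^ D) ((2ℚ ^ k) ^ D′) ((2ℚ ^ k′) ^ D) ⟩
    (x ^ D) ^ D′ * (2ℚ ^ k) ^ D′ * ((y ^ D′) ^ D * (2ℚ ^ k′) ^ D)
      ≡⟨ cong₂ _*_ (^-distrib-* (x ^ D) (2ℚ ^ k) D′) (^-distrib-* (y ^ D′) (2ℚ ^ k′) D) ⟨
    X ^ D′ * Y ^ D
      ≤⟨ *-mono-≤-nonNeg (<⇒≤ (^-pos D′ 0<X)) (<⇒≤ (^-pos D (^-pos j′ 0<2)))
           (^-mono-≤ D′ 0<X x≤) (^-mono-≤ D 0<Y y≤) ⟩
    (2ℚ ^ j) ^ D′ * (2ℚ ^ j′) ^ D
      ≡⟨ split j j′ ⟨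
    2ℚ ^ (j ℕ.* D′ ℕ.+ j′ ℕ.* D) ∎
  exponents : nat (j ℕ.* D′ ℕ.+ j′ ℕ.* D) ≤ (q + r) * nat (D ℕ.* D′) + nat (k ℕ.* D′ ℕ.+ k′ ℕ.* D)
  exponents = begin
    nat (j ℕ.* D′ ℕ.+ j′ ℕ.* D)
      ≡⟨ nat-split j j′ ⟩
    nat j * nat D′ + nat j′ * nat D
      ≤⟨ +-mono-≤ (*-mono-≤ʳ (0≤nat D′) j≤) (*-mono-≤ʳ (0≤nat D) j′≤) ⟩
    (q * nat D + nat k) * nat D′ + (r * nat D′ + nat k′) * nat D
      ≡⟨ solve 6 (λ q r D D′ k k′ → (q :* D :+ k) :* D′ :+ (r :* D′ :+ k′) :* D
            := (q :+ r) :* (D :* D′) :+ (k :* D′ :+ k′ :* D)) refl q r (nat D) (nat D′) (nat k) (nat k′) ⟩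
    (q + r) * (nat D * nat D′) + (nat k * nat D′ + nat k′ * nat D)
      ≡⟨ cong₂ (λ s t → (q + r) * s + t) (nat-* D D′) (nat-split k k′) ⟨
    (q + r) * nat (D ℕ.* D′) + nat (k ℕ.* D′ ℕ.+ k′ ℕ.* D) ∎

logBound-∏ℓ : ∀ {a} {A : Set a} xs {g q : A → ℚ} → (∀ x → 0ℚ < g x) → (∀ x → LogBound (g x) (q x)) →
  LogBound (∏ℓ xs g) (∑ℓ xs q)
logBound-∏ℓ []       0<g bound = logBound-1
logBound-∏ℓ (x ∷ xs) 0<g bound =
  logBound-* (0<g x) (∏ℓ-pos xs 0<g) (bound x) (logBound-∏ℓ xs 0<g bound)

-- Takes the logarithm of the final inequality: its `D`-th power combined with the certificate
-- compares two powers of two, hence the natural exponents `k` and `m * D + j`.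
logBound-exponent : ∀ {x q} m → 0ℚ < x → LogBound x q → 1ℚ ≤ 2ℚ ^ m * x → 0ℚ ≤ nat m + q
logBound-exponent {x} {q} m 0<x (logBound d j k x≤ j≤) 1≤ = *-cancelʳ-≤′ (0<nat-suc d) (begin
  0ℚ * nat D                                 ≡⟨ solve 2 (λ D k → con 0ℚ :* D := k :- k) refl (nat D) (nat k) ⟩
  nat k - nat k                              ≤⟨ +-monoˡ-≤ (- nat k) (nat-mono-≤ (2^-cancel-≤ {k} {m ℕ.* D ℕ.+ j} 2^k≤)) ⟩
  nat (m ℕ.* D ℕ.+ j) - nat k                ≡⟨ cong (_- nat k) (trans (nat-+ (m ℕ.* D) j) (cong (_+ nat j) (nat-* m D))) ⟩
  nat m * nat D + nat j - nat k              ≤⟨ +-monoˡ-≤ (- nat k) (+-monoʳ-≤ (nat m * nat D) j≤) ⟩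
  nat m * nat D + (q * nat D + nat k) - nat k
    ≡⟨ solve 4 (λ m q D k → m :* D :+ (q :* D :+ k) :- k := (m :+ q) :* D) refl (nat m) q (nat D) (nat k) ⟩
  (nat m + q) * nat D ∎)
  where
  open ≤-Reasoning
  D : ℕ
  D = suc d
  2^k≤ : 2ℚ ^ k ≤ 2ℚ ^ (m ℕ.* D ℕ.+ j)
  2^k≤ = begin
    2ℚ ^ k                            ≡⟨ *-identityˡ (2ℚ ^ k) ⟨
    1ℚ * 2ℚ ^ k                       ≡⟨ cong (_* 2ℚ ^ k) (1^ D) ⟨
    1ℚ ^ D * 2ℚ ^ k                   ≤⟨ *-mono-≤ʳ (<⇒≤ (^-pos k 0<2)) (^-mono-≤ D 0<1 1≤) ⟩
    (2ℚ ^ m * x) ^ D * 2ℚ ^ k         ≡⟨ cong (_* 2ℚ ^ k) (^-distrib-* (2ℚ ^ m) x D) ⟩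
    (2ℚ ^ m) ^ D * x ^ D * 2ℚ ^ k     ≡⟨ *-assoc ((2ℚ ^ m) ^ D) (x ^ D) (2ℚ ^ k) ⟩
    (2ℚ ^ m) ^ D * (x ^ D * 2ℚ ^ k)   ≤⟨ *-mono-≤ˡ (<⇒≤ (^-pos D (^-pos m 0<2))) x≤ ⟩
    (2ℚ ^ m) ^ D * 2ℚ ^ j             ≡⟨ cong (_* 2ℚ ^ j) (^-assocʳ 2ℚ m D) ⟩
    2ℚ ^ (m ℕ.* D) * 2ℚ ^ j           ≡⟨ ^-homo-* 2ℚ (m ℕ.* D) j ⟨
    2ℚ ^ (m ℕ.* D ℕ.+ j)              ∎

-- Real numbers with a rational value

-- The order is defined by lower cuts alone; locatedness transfers it to upper cuts. A bracket of
-- `x` shorter than `q - q′` starts below `q′`, so it ends below `q`.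
≤ᵣ-upper : ∀ x y {q} → x ≤ᵣ y → upper y q → upper x q
≤ᵣ-upper x y x≤y q∈ =
  let (q′ , q′<q , q′∈) = upper-open y q∈
      (l , h , l∈ , h∈ , h-l<) = located x (<⇒0<- q′<q)
      l<q′ = disjoint y (x≤y l∈) q′∈
  in upper-up x (add-pos⇒< (0<+ (<⇒0<- h-l<) (<⇒0<- l<q′))
       (solve 4 (λ l h q q′ → h :+ ((q :- q′ :- (h :- l)) :+ (q′ :- l)) := q) refl l h _ q′)) h∈

fromℚ-cancel-≤ : ∀ {p q} → fromℚ p ≤ᵣ fromℚ q → p ≤ q
fromℚ-cancel-≤ p≤q = ≤-from-< (λ r<p → <⇒≤ (p≤q r<p))

-- Phrased as inequalities with points of the cuts, since the sides of boxes and the bases inside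
-- logarithms are such points.
record HasValue (x : ℝ) (s : ℚ) : Set where
  constructor hasValue
  field
    lower-≤ : ∀ {l} → lower x l → l ≤ s
    ≤-upper : ∀ {h} → upper x h → s ≤ h

open HasValue

value-≃ : ∀ {x s a} → HasValue x s → x ≃ᵣ fromℚ a → s ≡ a
value-≃ {x} {s} {a} v (x≤a , a≤x) = ≤-antisym
  (≤-from-> λ a<r → ≤-upper v (≤ᵣ-upper x (fromℚ a) x≤a a<r))
  (≤-from-< λ r<a → lower-≤ v (a≤x r<a))

value-pos : ∀ {x s} → HasValue x s → 0ᵣ <ᵣ x → 0ℚ < s
value-pos v (q , 0<q , q∈) = <-≤-trans 0<q (lower-≤ v q∈)

value-∑ : ∀ {b} {p : Fin b → ℝ} {s : Fin b → ℚ} → (∀ i → HasValue (p i) (s i)) →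
  HasValue (∑ p) (ℚΣ.sum s)
value-∑ {zero}  v = hasValue <⇒≤ <⇒≤
value-∑ {suc b} v = hasValue
  (λ (_ , _ , a∈ , b∈ , q≤) → ≤-trans q≤ (+-mono-≤ (lower-≤ (v zero) a∈) (lower-≤ (value-∑ (v ∘ suc)) b∈)))
  (λ (_ , _ , a∈ , b∈ , ≤q) → ≤-trans (+-mono-≤ (≤-upper (v zero) a∈) (≤-upper (value-∑ (v ∘ suc)) b∈)) ≤q)

-- Division by `ν` read off from boxes: a point `l` below `p`, joined with the left side of a box
-- around `(p , ν)`, stays in that box, so the box maximum bounds `l * ν`. The upper half is dual.
value-quotient : ∀ {p ν a s} → 0ℚ < ν → p *ᵣ fromℚ ν ≃ᵣ fromℚ a → s * ν ≡ a → HasValue p s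
value-quotient {p} {ν} {a} {s} 0<ν (pν≤a , a≤pν) refl = hasValue below above
  where
  below : ∀ {l} → lower p l → l ≤ s
  below {l} l∈ = *-cancelʳ-≤′ 0<ν (≤-from-> λ {q} a<q →
    let (B , max<q) = ≤ᵣ-upper (p *ᵣ fromℚ ν) (fromℚ a) pν≤a a<q
        open Box B
    in ≤-trans (*-mono-≤ʳ (<⇒≤ 0<ν) (p≤p⊔q l (Box.a B)))
         (≤-trans (≤max (p≤q⊔p l (Box.a B)) (<⇒≤ (disjoint p (lower-⊔ p l∈ a<x) x<b)) (<⇒≤ c<y) (<⇒≤ y<d))
           (<⇒≤ max<q)))
  above : ∀ {h} → upper p h → s ≤ h
  above {h} h∈ = *-cancelʳ-≤′ 0<ν (≤-from-< λ {q} q<a →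
    let (B , q<min) = a≤pν q<a
        open Box B
    in ≤-trans (<⇒≤ q<min)
         (≤-trans (min≤ (<⇒≤ (disjoint p a<x (upper-⊓ p h∈ x<b))) (p⊓q≤q h (Box.b B)) (<⇒≤ c<y) (<⇒≤ y<d))
           (*-mono-≤ʳ (<⇒≤ 0<ν) (p⊓q≤p h (Box.b B)))))

upper-log : ∀ {x s q} (x>0 : 0ᵣ <ᵣ x) → HasValue x s → 0ℚ < s → upper (log x x>0) q → LogBound s q
upper-log {q = q} _ v 0<s (r , j , k , d , r∈ , r≤ , <q) = logBound d j k
  (≤-trans (*-mono-≤ʳ (<⇒≤ (^-pos k 0<2)) (^-mono-≤ (suc d) 0<s (≤-upper v r∈))) r≤)
  (≤-trans (≤-reflexive (sym (⊖/*nat j k d)))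
    (+-monoˡ-≤ (nat k) (*-mono-≤ʳ (0≤nat (suc d)) (<⇒≤ <q))))

-- For `r` below `1 / x` and `l` below `x` one has `l * r ≤ 1`, so a lower certificate for `r`
-- becomes an upper certificate for `l` with `j` and `k` exchanged.
lower-log-inverse : ∀ {x l q} (x>0 : 0ᵣ <ᵣ x) → lower x l → 0ℚ < l →
  lower (log (inverse x x>0) (inverse-pos x x>0)) q → LogBound l (- q)
lower-log-inverse {x} {l} {q} _ l∈ 0<l (r , j , k , d , (r′ , t , r′∈ , tr′≤1 , r<t) , 0<r , ≤r , q<) =
  logBound d k j power exponents
  where
  open ≤-Reasoning
  D : ℕ
  D = suc d
  l<r′ : l < r′
  l<r′ = disjoint x l∈ r′∈
  lr≤1 : l * r ≤ 1ℚ
  lr≤1 = begin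
    l * r   ≤⟨ *-mono-≤-nonNeg (<⇒≤ 0<l) (<⇒≤ (<-trans 0<r r<t)) (<⇒≤ l<r′) (<⇒≤ r<t) ⟩
    r′ * t  ≡⟨ *-comm r′ t ⟩
    t * r′  ≤⟨ tr′≤1 ⟩
    1ℚ      ∎
  power : l ^ D * 2ℚ ^ j ≤ 2ℚ ^ k
  power = begin
    l ^ D * 2ℚ ^ j            ≤⟨ *-mono-≤ˡ (<⇒≤ (^-pos D 0<l)) ≤r ⟩
    l ^ D * (r ^ D * 2ℚ ^ k)  ≡⟨ *-assoc (l ^ D) (r ^ D) (2ℚ ^ k) ⟨
    l ^ D * r ^ D * 2ℚ ^ k    ≡⟨ cong (_* 2ℚ ^ k) (^-distrib-* l r D) ⟨
    (l * r) ^ D * 2ℚ ^ k      ≤⟨ *-mono-≤ʳ (<⇒≤ (^-pos k 0<2)) (^-mono-≤ D (0<* 0<l 0<r) lr≤1) ⟩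
    1ℚ ^ D * 2ℚ ^ k           ≡⟨ cong (_* 2ℚ ^ k) (1^ D) ⟩
    1ℚ * 2ℚ ^ k               ≡⟨ *-identityˡ (2ℚ ^ k) ⟩
    2ℚ ^ k                    ∎
  exponents : nat k ≤ - q * nat D + nat j
  exponents = begin
    nat k
      ≡⟨ solve 3 (λ q D k → k := :- q :* D :+ (q :* D :+ k)) refl q (nat D) (nat k) ⟩
    - q * nat D + (q * nat D + nat k)
      ≤⟨ +-monoʳ-≤ (- q * nat D) (+-monoˡ-≤ (nat k) (*-mono-≤ʳ (0≤nat D) (<⇒≤ q<))) ⟩
    - q * nat D + ((j ⊖ k) / D * nat D + nat k)
      ≡⟨ cong (λ z → - q * nat D + z) (⊖/*nat j k d) ⟩
    - q * nat D + nat j ∎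

-- Extracts one rational bound per logarithm from a point above the whole sum. The bound is the
-- upper edge of the box around `(p i , log (p i))`; since `s i` lies within the other side,
-- `s i * d i` is at most the box maximum, whatever the sign of the logarithm.
upper-∑-log : ∀ {b} {p : Fin b → ℝ} {s : Fin b → ℚ} (p>0 : ∀ i → 0ᵣ <ᵣ p i) →
  (∀ i → HasValue (p i) (s i)) → (∀ i → 0ℚ < s i) →
  ∀ {q} → upper (∑ (λ i → p i *ᵣ log (p i) (p>0 i))) q →
  Σ (Fin b → ℚ) λ d → (∀ i → LogBound (s i) (d i)) × ℚΣ.sum (λ i → s i * d i) ≤ q
upper-∑-log {zero}  p>0 v 0<s 0<q = (λ ()) , (λ ()) , <⇒≤ 0<q
upper-∑-log {suc b} {p} {s} p>0 v 0<s (a , a′ , (B , max<a) , a′∈ , ≤q) =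
  let (d , bound , ∑≤) = upper-∑-log {p = p ∘ suc} {s ∘ suc} (p>0 ∘ suc) (v ∘ suc) (0<s ∘ suc) a′∈
  in extend d , extend-bound d bound , ≤-trans (+-mono-≤ (≤-trans s₀d≤max (<⇒≤ max<a)) ∑≤) ≤q
  where
  extend : (Fin b → ℚ) → Fin (suc b) → ℚ
  extend d zero    = Box.d B
  extend d (suc i) = d i
  extend-bound : ∀ d → (∀ i → LogBound (s (suc i)) (d i)) → ∀ i → LogBound (s i) (extend d i)
  extend-bound d bound zero =
    upper-log {p zero} {s zero} {Box.d B} (p>0 zero) (v zero) (0<s zero) (Box.y<d B)
  extend-bound d bound (suc i) = bound i
  s₀d≤max : s zero * Box.d B ≤ Box.max B
  s₀d≤max = Box.≤max B (lower-≤ (v zero) (Box.a<x B)) (≤-upper (v zero) (Box.x<b B))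
    (<⇒≤ (disjoint (log (p zero) (p>0 zero)) (Box.c<y B) (Box.y<d B))) ≤-refl

-- Choice of the rational constants

small-log : ∀ {δ} → 0ℚ < δ → ∃[ t ] (1ℚ < t × LogBound t δ)
small-log {δ} 0<δ with d , 4/D<δ ← archimedean 0<δ =
  1ℚ + ρ , 1<1+ρ , logBound d 1 0 power exponents
  where
  open ≤-Reasoning
  D : ℕ
  D = suc d
  c : ℚ
  c = 2ℚ * nat D
  0<c : 0ℚ < c
  0<c = 0<* 0<2 (0<nat-suc d)
  instance
    c>0 = positive 0<c
    c≢0 = pos⇒nonZero c
  -- With `ρ = 1 / (2 * D)`, Bernoulli's inequality gives `(1 + ρ) ^ D ≤ 2`, so
  -- `log (1 + ρ) ≤ 1 / D`, well below `δ`.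
  ρ : ℚ
  ρ = 1/ c
  1<1+ρ : 1ℚ < 1ℚ + ρ
  1<1+ρ = add-pos⇒< (positive⁻¹ ρ {{1/pos⇒pos c}}) refl
  small : (1ℚ + ρ - 1ℚ) * c ≤ 1ℚ + ρ
  small = begin
    (1ℚ + ρ - 1ℚ) * c  ≡⟨ cong (_* c) (solve 1 (λ r → con 1ℚ :+ r :- con 1ℚ := r) refl ρ) ⟩
    ρ * c              ≡⟨ *-inverseˡ c ⟩
    1ℚ                 ≤⟨ <⇒≤ 1<1+ρ ⟩
    1ℚ + ρ             ∎
  power : (1ℚ + ρ) ^ D * 2ℚ ^ 0 ≤ 2ℚ ^ 1
  power = begin
    (1ℚ + ρ) ^ D * 1ℚ   ≡⟨ *-identityʳ ((1ℚ + ρ) ^ D) ⟩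
    (1ℚ + ρ) ^ D        ≤⟨ ^-doubling D 0<1 (<⇒≤ 1<1+ρ) small ⟩
    2ℚ * 1ℚ ^ D         ≡⟨ cong (2ℚ *_) (1^ D) ⟩
    2ℚ * 1ℚ             ∎
  exponents : nat 1 ≤ δ * nat D + nat 0
  exponents = begin
    nat 1            ≤⟨ from-yes (nat 1 ≤? (+ 4 / 1)) ⟩
    + 4 / 1          ≡⟨ /*nat (+ 4) d ⟨
    + 4 / D * nat D  ≤⟨ *-mono-≤ʳ (0≤nat D) (<⇒≤ 4/D<δ) ⟩
    δ * nat D        ≡⟨ +-identityʳ (δ * nat D) ⟨
    δ * nat D + 0ℚ   ∎

-- A bracket of width below `s * (t - 1)` has ratio below `t` once its lower end is raised to at
-- least `s`.
approximate : ∀ {x t} → 0ᵣ <ᵣ x → 1ℚ < t → ∃[ l ] ∃[ h ] (0ℚ < l × lower x l × upper x h × h < l * t)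
approximate {x} {t} (s , 0<s , s∈) 1<t =
  let (l , h , l∈ , h∈ , h-l<) = located x (0<* 0<s (<⇒0<- 1<t))
      s≤ = p≤q⊔p l s
      h-l< = ≤-<-trans (+-monoʳ-≤ h (neg-antimono-≤ (p≤p⊔q l s)))
               (<-≤-trans h-l< (*-mono-≤ʳ (<⇒≤ (<⇒0<- 1<t)) s≤))
  in l ⊔ s , h , <-≤-trans 0<s s≤ , lower-⊔ x l∈ s∈ , h∈ ,
     add-pos⇒< (<⇒0<- h-l<)
       (solve 3 (λ h l t → h :+ (l :* (t :- con 1ℚ) :- (h :- l)) := l :* t) refl h (l ⊔ s) t)

-- The encoding bound

nat-∏ : ∀ {b} cs (g : Fin b → ℕ) → nat (∏ cs g) ≡ ∏ℓ cs (λ c → nat (g c))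
nat-∏ []       g = refl
nat-∏ (c ∷ cs) g = trans (nat-* (g c) (∏ cs g)) (cong (nat (g c) *_) (nat-∏ cs g))

nat-sum : ∀ {n} (g : Fin n → ℕ) → nat (sum g) ≡ ℚΣ.sum (λ i → nat (g i))
nat-sum {zero}  g = refl
nat-sum {suc n} g = trans (nat-+ (g zero) _) (cong (λ z → nat (g zero) + z) (nat-sum (g ∘ suc)))

nat-sum-≤ : ∀ {n} (g : Fin n → ℕ) {K} → (∀ i → nat (g i) ≤ K) → nat (sum g) ≤ nat n * K
nat-sum-≤ {zero}  g {K} g≤ = ≤-reflexive (sym (*-zeroˡ K))
nat-sum-≤ {suc n} g {K} g≤ = begin
  nat (g zero ℕ.+ sum (g ∘ suc))    ≡⟨ nat-+ (g zero) (sum (g ∘ suc)) ⟩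
  nat (g zero) + nat (sum (g ∘ suc)) ≤⟨ +-mono-≤ (g≤ zero) (nat-sum-≤ (g ∘ suc) (g≤ ∘ suc)) ⟩
  K + nat n * K                      ≡⟨ solve 2 (λ n K → K :+ n :* K := (con 1ℚ :+ n) :* K) refl (nat n) K ⟩
  nat (suc n) * K                    ∎
  where open ≤-Reasoning

∑ℓ-labels : ∀ {b} (k : Fin b → ℕ) (g : Fin b → ℚ) →
  ∑ℓ (labels k) g ≡ ℚΣ.sum (λ i → nat (k i) * g i)
∑ℓ-labels k g = trans (fold-labels +-0-monoid k g) (ℚΣ.sum-cong-≗ (λ i → ×≡nat* (k i) (g i)))
  where
  ×≡nat* : ∀ k x → k ×ℚ x ≡ nat k * x
  ×≡nat* zero    x = sym (*-zeroˡ x)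
  ×≡nat* (suc k) x = trans (cong (λ z → x + z) (×≡nat* k x))
    (solve 2 (λ k x → x :+ k :* x := (con 1ℚ :+ k) :* x) refl (nat k) x)

0≤ratio : ∀ a {d} → 0 ℕ.< d → 0ℚ ≤ ratio a d
0≤ratio a {d} 0<d = *-cancelʳ-≤′ (0<nat 0<d)
  (subst₂ _≤_ (sym (*-zeroˡ (nat d))) (sym (ratio*nat a 0<d)) (0≤nat a))

0<ratio : ∀ {a d} → 0 ℕ.< a → 0 ℕ.< d → 0ℚ < ratio a d
0<ratio {a} {d} 0<a 0<d = *-cancelʳ-<′ (0<nat 0<d)
  (subst₂ _<_ (sym (*-zeroˡ (nat d))) (sym (ratio*nat a 0<d)) (0<nat 0<a))

-- AM-GM for the numbers a c / k c, each repeated k c times; their sum is ∑ a.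
∏-labels-≤ : ∀ {b n K} (k a : Fin b → ℕ) → (∀ i → 0 ℕ.< k i) → sum k ≡ n → 0 ℕ.< n →
  nat (sum a) ≤ K → nat (∏ (labels k) a) ≤ ∏ℓ (labels k) (λ c → K * ratio (k c) n)
∏-labels-≤ {b} {n} {K} k a 0<k ∑k≡n 0<n ∑a≤K = begin
  nat (∏ cs a)
    ≡⟨ nat-∏ cs a ⟩
  ∏ℓ cs (λ c → nat (a c))
    ≡⟨ ∏ℓ-cong cs (λ c → ratio*nat (a c) (0<k c)) ⟨
  ∏ℓ cs (λ c → ratio (a c) (k c) * nat (k c))
    ≡⟨ ∏ℓ-distrib-* cs (λ c → ratio (a c) (k c)) (λ c → nat (k c)) ⟩
  ∏ℓ cs (λ c → ratio (a c) (k c)) * ∏ℓ cs (λ c → nat (k c))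
    ≤⟨ *-mono-≤ʳ (∏ℓ-nonNeg cs (λ c → 0≤nat (k c)))
         (am-gm cs (λ c → 0≤ratio (a c) (0<k c)) 0≤y ∑≤) ⟩
  y ^ length cs * ∏ℓ cs (λ c → nat (k c))
    ≡⟨ ∏ℓ-*ˡ cs y (λ c → nat (k c)) ⟨
  ∏ℓ cs (λ c → y * nat (k c))
    ≡⟨ ∏ℓ-cong cs (λ c → rescale (k c)) ⟩
  ∏ℓ cs (λ c → K * ratio (k c) n) ∎
  where
  open ≤-Reasoning
  cs = labels k
  -- `K / n` bounds the mean of the `n` numbers `a c / k c`; restoring the factor `k c` turns it
  -- into `K` times the frequency of `c`.
  y : ℚ
  y = K * ratio 1 n
  ny≡K : y * nat n ≡ K
  ny≡K = trans (*-assoc K (ratio 1 n) (nat n)) (trans (cong (K *_) (ratio*nat 1 0<n)) (*-identityʳ K))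
  0≤y : 0ℚ ≤ y
  0≤y = 0≤* (≤-trans (0≤nat (sum a)) ∑a≤K) (0≤ratio 1 0<n)
  rescale : ∀ j → y * nat j ≡ K * ratio j n
  rescale j = trans (cong (y *_) (sym (ratio*nat j 0<n)))
    (trans (solve 3 (λ y r n → y :* (r :* n) := y :* n :* r) refl y (ratio j n) (nat n))
      (cong (_* ratio j n) ny≡K))
  ∑≤ : ∑ℓ cs (λ c → ratio (a c) (k c)) ≤ nat (length cs) * y
  ∑≤ = begin
    ∑ℓ cs (λ c → ratio (a c) (k c))
      ≡⟨ ∑ℓ-labels k (λ c → ratio (a c) (k c)) ⟩
    ℚΣ.sum (λ i → nat (k i) * ratio (a i) (k i))
      ≡⟨ ℚΣ.sum-cong-≗ (λ i → trans (*-comm (nat (k i)) _) (ratio*nat (a i) (0<k i))) ⟩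
    ℚΣ.sum (λ i → nat (a i))
      ≡⟨ nat-sum a ⟨
    nat (sum a)
      ≤⟨ ∑a≤K ⟩
    K
      ≡⟨ trans (*-comm (nat n) y) ny≡K ⟨
    nat n * y
      ≡⟨ cong (λ j → nat j * y) (trans (length-labels k) ∑k≡n) ⟨
    nat (length cs) * y ∎

fromℚ-≤ : ∀ {q x h} → fromℚ q ≤ᵣ x → upper x h → q ≤ h
fromℚ-≤ {x = x} q≤x h∈ = ≤-from-< (λ r<q → <⇒≤ (disjoint x (q≤x r<q) h∈))

empty : ∀ {u b} → Answers u b
empty _ = nothing

module _ {b} {p : Fin b → ℝ} {n u} (M : PMap p n u) where

  open PMap M

  -- A single bad key makes the ratio positive. Its denominator is nonzero because that key belongs
  -- to the class, so the convention for empty sets cannot hide it.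
  error-free : ∀ {P : Fin u → Set} (P? : ∀ x → Dec (P x)) {i} →
    fromℚ (ratio (# (λ x → (value x ≟ₘ just i) ×-dec P? x)) (# (λ x → value x ≟ₘ just i))) ≤ᵣ 0ᵣ →
    ∀ {x} → value x ≡ just i → ¬ P x
  error-free P? {i} le {x} vx≡i Px = <⇒≱
    (0<ratio (#-pos (λ x → (value x ≟ₘ just i) ×-dec P? x) (vx≡i , Px)) (#-pos (λ x → value x ≟ₘ just i) vx≡i))
    (fromℚ-cancel-≤ le)

  encodes⇒agree : ∀ {s ε⁺} → Encodes M s ε⁺ 0ᵣ 0ᵣ → Agree value s
  encodes⇒agree {s} (_ , enc) {x} {i} vx≡i with s x in sx≡ | enc i
  ... | nothing | _ , f⁻≤0 = contradiction sx≡ (error-free (λ x → s x ≟ₘ nothing) f⁻≤0 vx≡i)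
  ... | just j  | f*≤0 , _ with just j ≟ₘ just i
  ...   | yes eq = eq
  ...   | no neq = contradiction ((λ eq → just≢nothing (trans (sym sx≡) eq)) , (λ eq → neq (trans (sym sx≡) eq)))
    (error-free (λ x → ¬? (s x ≟ₘ nothing) ×-dec ¬? (s x ≟ₘ just i)) f*≤0 vx≡i)
    where
    just≢nothing : ¬ just j ≡ nothing
    just≢nothing ()

  -- A position is answered by at most one value, and an answered position is either a key or a
  -- false positive.
  encodes⇒few-answers : ∀ {s ε⁺ h B} → Encodes M s ε⁺ 0ᵣ 0ᵣ → upper ε⁺ h →
    # (λ x → value x ≟ₘ nothing) ≡ B → 0 ℕ.< B →
    nat (sum (λ c → sum (λ x → 𝟙 (s x ≟ₘ just c)))) ≤ nat n + h * nat B
  encodes⇒few-answers {s} {ε⁺} {h} {B} (f⁺≤ε , _) ε<h refl 0<B = begin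
    nat (sum (λ c → sum (λ x → 𝟙 (s x ≟ₘ just c))))
      ≤⟨ nat-mono-≤ hits≤ ⟩
    nat (n ℕ.+ false⁺)
      ≡⟨ nat-+ n false⁺ ⟩
    nat n + nat false⁺
      ≡⟨ cong (λ z → nat n + z) (ratio*nat false⁺ 0<B) ⟨
    nat n + f⁺ M s * nat B
      ≤⟨ +-monoʳ-≤ (nat n) (*-mono-≤ʳ (0≤nat B) (fromℚ-≤ {x = ε⁺} f⁺≤ε ε<h)) ⟩
    nat n + h * nat B ∎
    where
    open ≤-Reasoning
    key? = λ x → ¬? (value x ≟ₘ nothing)
    false⁺? = λ x → (value x ≟ₘ nothing) ×-dec ¬? (s x ≟ₘ nothing)
    false⁺ : ℕ
    false⁺ = # false⁺?
    pointwise : ∀ (v w : Maybe (Fin b)) → sum (λ c → 𝟙 (w ≟ₘ just c)) ℕ.≤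
      𝟙 (¬? (v ≟ₘ nothing)) ℕ.+ 𝟙 ((v ≟ₘ nothing) ×-dec ¬? (w ≟ₘ nothing))
    pointwise v nothing = ℕ.≤-trans (ℕ.≤-reflexive (sum-0 {b} (λ c → 𝟙-no (nothing ≟ₘ just c) λ ()))) ℕ.z≤n
    pointwise v (just d) = ℕ.≤-trans (ℕ.≤-reflexive (trans
      (sum-cong-≗ {b} (λ c → trans (𝟙-cong (just d ≟ₘ just c) (just c ≟ₘ just d) sym sym)
        (sym (ℕ.*-identityˡ _)))) (sum-δ (const 1) d))) (1≤ v)
      where
      1≤ : ∀ v → 1 ℕ.≤ 𝟙 (¬? (v ≟ₘ nothing)) ℕ.+ 𝟙 ((v ≟ₘ nothing) ×-dec ¬? (just d ≟ₘ nothing))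
      1≤ nothing  = ℕ.≤-refl
      1≤ (just _) = ℕ.≤-refl
    hits≤ : sum (λ c → sum (λ x → 𝟙 (s x ≟ₘ just c))) ℕ.≤ n ℕ.+ false⁺
    hits≤ = ℕ.≤-trans (ℕ.≤-reflexive (∑-comm {b} {u} (λ c x → 𝟙 (s x ≟ₘ just c))))
      (ℕ.≤-trans (sum-mono-≤ (λ x → pointwise (value x) (s x)))
        (ℕ.≤-reflexive (trans (∑-distrib-+ (λ x → 𝟙 (key? x)) (λ x → 𝟙 (false⁺? x)))
          (cong₂ ℕ._+_ (trans (sym (#-sum key?)) keys-size) (sym (#-sum false⁺?))))))

module _ {b u} (k : Fin b → ℕ) {f : Answers u b} (grow : Grow empty (labels k) f) where

  private
    cs = labels k

  #-Grow : (h : Maybe (Fin b) → ℕ) → h nothing ≡ 0 → sum (h ∘ f) ≡ foldr (λ c → h (just c) ℕ.+_) 0 cs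
  #-Grow h h∅≡0 = begin
    sum (h ∘ f)                             ≡⟨ ℕ.+-identityʳ _ ⟨
    sum (h ∘ f) ℕ.+ 0                       ≡⟨ cong (sum (h ∘ f) ℕ.+_) (trans (cong (length cs ℕ.*_) h∅≡0) (ℕ.*-zeroʳ (length cs))) ⟨
    sum (h ∘ f) ℕ.+ length cs ℕ.* h nothing ≡⟨ sum-Grow h grow ⟩
    sum {u} (const (h nothing)) ℕ.+ r       ≡⟨ cong (ℕ._+ r) (sum-0 {u} (const h∅≡0)) ⟩
    r                                       ∎
    where
    open ≡-Reasoning
    r : ℕ
    r = foldr (λ c → h (just c) ℕ.+_) 0 cs

  keys-Grow : # (λ x → ¬? (f x ≟ₘ nothing)) ≡ sum k
  keys-Grow = trans (#-sum (λ x → ¬? (f x ≟ₘ nothing)))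
    (trans (#-Grow (λ v → 𝟙 (¬? (v ≟ₘ nothing))) refl) (length-labels k))

  values-Grow : ∀ i → # (λ x → f x ≟ₘ just i) ≡ k i
  values-Grow i = trans (#-sum (λ x → f x ≟ₘ just i))
    (trans (#-Grow (λ v → 𝟙 (v ≟ₘ just i)) refl) (occurrences-labels k i))

  free-Grow : # (λ x → f x ≟ₘ nothing) ℕ.+ sum k ≡ u
  free-Grow = begin
    # (λ x → f x ≟ₘ nothing) ℕ.+ sum k
      ≡⟨ cong₂ ℕ._+_ (#-sum (λ x → f x ≟ₘ nothing)) (trans (sym (length-labels k)) (sym (ℕ.*-identityʳ _))) ⟩
    sum (undefinedAt ∘ f) ℕ.+ length cs ℕ.* 1
      ≡⟨ sum-Grow undefinedAt grow ⟩
    sum {u} (const 1) ℕ.+ foldr (λ c → 0 ℕ.+_) 0 cs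
      ≡⟨ cong₂ ℕ._+_ (trans (sum-const u 1) (ℕ.*-identityʳ u)) (foldr-id cs) ⟩
    u ℕ.+ 0
      ≡⟨ ℕ.+-identityʳ u ⟩
    u ∎
    where
    open ≡-Reasoning
    foldr-id : ∀ (xs : List (Fin b)) → foldr (λ c s → s) 0 xs ≡ 0
    foldr-id []       = refl
    foldr-id (x ∷ xs) = foldr-id xs

-- Writing `B = u - n`, the margin assumption gives `n + h * B ≤ e * B`. Each of the `n` factors
-- then carries one `B`, and these cancel against the `B ^ n` placements, which removes the universe
-- from the conclusion.
encoding-bound : ∀ {b n u m} {p : Fin b → ℝ} {ε⁺ h e} (k : Fin b → ℕ) → (∀ i → 0 ℕ.< k i) →
  sum k ≡ n → 0 ℕ.< n → n ℕ.< u →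
  (∀ i → fromℕ (k i) ≃ᵣ p i *ᵣ fromℕ n) →
  upper ε⁺ h → 0ℚ < e → nat n ≤ (e - h) * nat (u ℕ.∸ n) →
  (D : DataStructure m u b) → EncodesAll D p n ε⁺ 0ᵣ 0ᵣ →
  1ℚ ≤ 2ℚ ^ m * ∏ℓ (labels k) (λ c → e * ratio (k c) n)
encoding-bound {b} {n} {u} {m} {p} {ε⁺} {h} {e} k 0<k ∑k≡n 0<n n<u sizes ε<h 0<e n≤ D encodes =
  *-cancelʳ-≤′ (^-pos (length cs) 0<B) (begin
    1ℚ * nat B ^ length cs
      ≡⟨ *-identityˡ _ ⟩
    nat B ^ length cs
      ≡⟨ nat-^ B (length cs) ⟨
    nat (B ℕ.^ length cs)
      ≤⟨ nat-mono-≤ (growth-bound E B cs empty w room encode) ⟩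
    nat (sum (λ σ → w σ ℕ.* ∏ cs (hits E σ)))
      ≤⟨ nat-sum-≤ (λ σ → w σ ℕ.* ∏ cs (hits E σ)) term≤ ⟩
    nat (2 ℕ.^ m) * ∏ℓ cs (λ c → K * ratio (k c) n)
      ≡⟨ cong₂ _*_ (nat-^ 2 m) (trans (∏ℓ-cong cs (λ c → shuffle (ratio (k c) n)))
           (∏ℓ-*ˡ cs (nat B) (λ c → e * ratio (k c) n))) ⟩
    2ℚ ^ m * (nat B ^ length cs * ∏ℓ cs (λ c → e * ratio (k c) n))
      ≡⟨ solve 3 (λ x y z → x :* (y :* z) := x :* z :* y) refl (2ℚ ^ m) (nat B ^ length cs) _ ⟩
    2ℚ ^ m * ∏ℓ cs (λ c → e * ratio (k c) n) * nat B ^ length cs ∎)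
  where
  open ≤-Reasoning
  cs = labels k
  B : ℕ
  B = u ℕ.∸ n
  B+n≡u : B ℕ.+ n ≡ u
  B+n≡u = ℕ.m∸n+n≡m (ℕ.<⇒≤ n<u)
  0<B = 0<nat (ℕ.m<n⇒0<n∸m n<u)
  K : ℚ
  K = e * nat B
  shuffle : ∀ r → K * r ≡ nat B * (e * r)
  shuffle r = solve 3 (λ e B r → e :* B :* r := B :* (e :* r)) refl e (nat B) r
  E : Fin (2 ℕ.^ m) → Answers u b
  E σ = D (bits σ)
  good? : ∀ σ → Dec (nat (sum (hits E σ)) ≤ K)
  good? σ = nat (sum (hits E σ)) ≤? K
  -- Strings with more than `K` answers encode no map, so they may start with weight 0; AM-GM is
  -- then applied only where the total is at most `K`.
  w : Fin (2 ℕ.^ m) → ℕ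
  w σ = 𝟙 (good? σ)
  room : B ℕ.+ length cs ℕ.≤ sum {u} (λ _ → 1)
  room = ℕ.≤-reflexive (trans (cong (B ℕ.+_) (trans (length-labels k) ∑k≡n))
    (trans B+n≡u (sym (trans (sum-const u 1) (ℕ.*-identityʳ u)))))
  toPMap : ∀ {f} → Grow empty cs f → PMap p n u
  toPMap {f} grow = record
    { value       = f
    ; keys-size   = trans (keys-Grow k grow) ∑k≡n
    ; values-size = λ i → subst (λ j → fromℕ j ≃ᵣ p i *ᵣ fromℕ n) (sym (values-Grow k grow i)) (sizes i)
    }
  encode : ∀ {f} → Grow empty cs f → ∃[ σ ] (1 ℕ.≤ w σ × Agree f (E σ))
  encode {f} grow =
    let M = toPMap grow
        (s , enc) = encodes M
        (σ , σ≡s) = bits-surjective s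
        enc′ = subst (λ s → Encodes M (D s) ε⁺ 0ᵣ 0ᵣ) (sym σ≡s) enc
        free≡B = ℕ.+-cancelʳ-≡ n _ _ (trans (cong (λ j → # (λ x → f x ≟ₘ nothing) ℕ.+ j) (sym ∑k≡n))
                   (trans (free-Grow k grow) (sym B+n≡u)))
        few = encodes⇒few-answers M {E σ} {ε⁺} enc′ ε<h free≡B (ℕ.m<n⇒0<n∸m n<u)
    in σ , ℕ.≤-reflexive (sym (𝟙-yes (good? σ) (≤-trans few few≤K))) , encodes⇒agree M {E σ} {ε⁺} enc′
    where
    few≤K : nat n + h * nat B ≤ K
    few≤K = ≤-trans (+-monoˡ-≤ (h * nat B) n≤) (≤-reflexive
      (solve 3 (λ e h B → (e :- h) :* B :+ h :* B := e :* B) refl e h (nat B)))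
  0≤K : 0ℚ ≤ K
  0≤K = 0≤* (<⇒≤ 0<e) (<⇒≤ 0<B)
  term≤ : ∀ σ → nat (w σ ℕ.* ∏ cs (hits E σ)) ≤ ∏ℓ cs (λ c → K * ratio (k c) n)
  term≤ σ = bound (good? σ)
    where
    bound : (good : Dec (nat (sum (hits E σ)) ≤ K)) →
      nat (𝟙 good ℕ.* ∏ cs (hits E σ)) ≤ ∏ℓ cs (λ c → K * ratio (k c) n)
    bound (yes le) = ≤-trans (≤-reflexive (cong nat (ℕ.*-identityˡ (∏ cs (hits E σ)))))
      (∏-labels-≤ k (hits E σ) 0<k ∑k≡n 0<n le)
    bound (no _) = ∏ℓ-nonNeg cs (λ c → 0≤* 0≤K (0≤ratio (k c) 0<n))

-- The limit

-- If some p i is irrational then no n is admissible and the theorem is vacuous,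
-- so only rational probabilities matter.
frequencies : ∀ {b} {p : Fin b → ℝ} → (∀ i → 0ᵣ <ᵣ p i) → ∑ p ≃ᵣ 1ᵣ → ∀ {n} → Admissible p n →
  Σ (Fin b → ℕ) λ k → (∀ i → 0 ℕ.< k i) × sum k ≡ n ×
    (∀ i → fromℕ (k i) ≃ᵣ p i *ᵣ fromℕ n) × (∀ i → HasValue (p i) (ratio (k i) n))
frequencies {b} {p} p>0 ∑p≃1 {n} (0<n , integral) =
  k , 0<k , ∑k≡n , sizes , values
  where
  0<n/1 : 0ℚ < + n / 1
  0<n/1 = subst (0ℚ <_) (nat≡/1 n) (0<nat 0<n)
  z : Fin b → ℤ
  z i = proj₁ (integral i)
  r : ℚ
  r = ratio 1 n
  values′ : ∀ i → HasValue (p i) (z i / 1 * r)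
  values′ i = value-quotient {p i} {+ n / 1} 0<n/1 (proj₂ (integral i))
    (trans (cong (z i / 1 * r *_) (sym (nat≡/1 n))) (trans (*-assoc (z i / 1) r (nat n))
      (trans (cong (z i / 1 *_) (ratio*nat 1 0<n)) (*-identityʳ (z i / 1)))))
  -- Admissibility supplies integers only; positivity of `p i` makes them positive class sizes.
  natural : ∀ a → 0ℚ < a / 1 * r → ∃[ j ] (0 ℕ.< j × a ≡ + j)
  natural (+ zero)    0<zr = contradiction (≤-reflexive (*-zeroˡ r)) (<⇒≱ 0<zr)
  natural (+ suc j)   0<zr = suc j , ℕ.s≤s ℕ.z≤n , refl
  natural ℤ.-[1+ j ] 0<zr = contradiction
    (≤-trans (*-mono-≤ʳ (0≤ratio 1 0<n) (<⇒≤ (/-mono-< {ℤ.-[1+ j ]} {+ 0} {0} {0} ℤ.-<+)))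
      (≤-reflexive (*-zeroˡ r)))
    (<⇒≱ 0<zr)
  nats : ∀ i → ∃[ j ] (0 ℕ.< j × z i ≡ + j)
  nats i = natural (z i) (value-pos {p i} (values′ i) (p>0 i))
  k : Fin b → ℕ
  k i = proj₁ (nats i)
  0<k : ∀ i → 0 ℕ.< k i
  0<k i = proj₁ (proj₂ (nats i))
  z≡k : ∀ i → z i ≡ + k i
  z≡k i = proj₂ (proj₂ (nats i))
  sizes : ∀ i → fromℕ (k i) ≃ᵣ p i *ᵣ fromℕ n
  sizes i =
    let (≤k , k≤) = subst (λ a → p i *ᵣ fromℕ n ≃ᵣ fromℚ (a / 1)) (z≡k i) (proj₂ (integral i))
    in k≤ , ≤k
  value≡ : ∀ i → z i / 1 * r ≡ ratio (k i) n
  value≡ i = *-cancelʳ-≡ 0<n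
    (trans (*-assoc (z i / 1) r (nat n)) (trans (cong (z i / 1 *_) (ratio*nat 1 0<n))
      (trans (*-identityʳ (z i / 1)) (trans (cong (_/ 1) (z≡k i))
        (trans (sym (nat≡/1 (k i))) (sym (ratio*nat (k i) 0<n)))))))
    where
    *-cancelʳ-≡ : ∀ {x y n} → 0 ℕ.< n → x * nat n ≡ y * nat n → x ≡ y
    *-cancelʳ-≡ 0<n eq = ≤-antisym (*-cancelʳ-≤′ (0<nat 0<n) (≤-reflexive eq))
                                   (*-cancelʳ-≤′ (0<nat 0<n) (≤-reflexive (sym eq)))
  values : ∀ i → HasValue (p i) (ratio (k i) n)
  values i = subst (HasValue (p i)) (value≡ i) (values′ i)
  ∑k≡n : sum k ≡ n
  ∑k≡n = nat-injective (begin
    nat (sum k)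
      ≡⟨ nat-sum k ⟩
    ℚΣ.sum (λ i → nat (k i))
      ≡⟨ ℚΣ.sum-cong-≗ (λ i → ratio*nat (k i) 0<n) ⟨
    ℚΣ.sum (λ i → ratio (k i) n * nat n)
      ≡⟨ ℚΣ.*-distribʳ-sum (nat n) (λ i → ratio (k i) n) ⟨
    ℚΣ.sum (λ i → ratio (k i) n) * nat n
      ≡⟨ cong (_* nat n) (value-≃ {∑ p} (value-∑ {p = p} values) ∑p≃1) ⟩
    1ℚ * nat n
      ≡⟨ *-identityˡ (nat n) ⟩
    nat n ∎)
    where open ≡-Reasoning

-- The threshold `δ = κ / (1 + κ)` is the one for which `n / u < δ` amounts to `n < κ * (u - n)`.
-- The bound `n < u` ensures that the truncated difference is the true one.
sparse : ∀ {κ n u} → 0ℚ < κ → 0 ℕ.< u → ∀ {δ} → δ * (1ℚ + κ) ≡ κ → ratio n u < δ →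
  0 ℕ.< n → n ℕ.< u × nat n ≤ κ * nat (u ℕ.∸ n)
sparse {κ} {n} {u} 0<κ 0<u {δ} δ[1+κ]≡κ n/u<δ 0<n = n<u , n≤
  where
  open ≤-Reasoning
  0<1+κ : 0ℚ < 1ℚ + κ
  0<1+κ = 0<+ 0<1 0<κ
  n[1+κ]<κu : nat n * (1ℚ + κ) < κ * nat u
  n[1+κ]<κu = begin-strict
    nat n * (1ℚ + κ)               ≡⟨ cong (_* (1ℚ + κ)) (ratio*nat n 0<u) ⟨
    ratio n u * nat u * (1ℚ + κ)   <⟨ *-mono-<ʳ 0<1+κ (*-mono-<ʳ (0<nat 0<u) n/u<δ) ⟩
    δ * nat u * (1ℚ + κ)           ≡⟨ solve 3 (λ d u k → d :* u :* k := d :* k :* u) refl δ (nat u) (1ℚ + κ) ⟩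
    δ * (1ℚ + κ) * nat u           ≡⟨ cong (_* nat u) δ[1+κ]≡κ ⟩
    κ * nat u                      ∎
  n<u : n ℕ.< u
  n<u = ℕ.≰⇒> λ u≤n → <⇒≱ n[1+κ]<κu (begin
    κ * nat u         ≤⟨ *-mono-≤ˡ (<⇒≤ 0<κ) (nat-mono-≤ u≤n) ⟩
    κ * nat n         ≤⟨ add-nonNeg⇒≤ (0≤nat n) (solve 2 (λ k n → k :* n :+ n := n :* (con 1ℚ :+ k)) refl κ (nat n)) ⟩
    nat n * (1ℚ + κ)  ∎)
  n≤ : nat n ≤ κ * nat (u ℕ.∸ n)
  n≤ = begin
    nat n
      ≡⟨ solve 2 (λ n k → n := n :* (con 1ℚ :+ k) :- k :* n) refl (nat n) κ ⟩
    nat n * (1ℚ + κ) - κ * nat n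
      ≤⟨ +-monoˡ-≤ (- (κ * nat n)) (<⇒≤ n[1+κ]<κu) ⟩
    κ * nat u - κ * nat n
      ≡⟨ cong (λ j → κ * nat j - κ * nat n) (ℕ.m∸n+n≡m (ℕ.<⇒≤ n<u)) ⟨
    κ * nat (u ℕ.∸ n ℕ.+ n) - κ * nat n
      ≡⟨ cong (λ x → κ * x - κ * nat n) (nat-+ (u ℕ.∸ n) n) ⟩
    κ * (nat (u ℕ.∸ n) + nat n) - κ * nat n
      ≡⟨ solve 3 (λ k B n → k :* (B :+ n) :- k :* n := k :* B) refl κ (nat (u ℕ.∸ n)) (nat n) ⟩
    κ * nat (u ℕ.∸ n) ∎

-- The logarithm of the encoding bound, divided by `n`: label `i` contributes `C + d i` exactly
-- `k i` times, so the average over the list is `C` plus the sum of the `d i` weighted by frequency.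
rate-bound : ∀ {b n m e C} (k : Fin b → ℕ) (d : Fin b → ℚ) → (∀ i → 0 ℕ.< k i) → sum k ≡ n → 0 ℕ.< n →
  0ℚ < e → LogBound e C → (∀ i → LogBound (ratio (k i) n) (d i)) →
  1ℚ ≤ 2ℚ ^ m * ∏ℓ (labels k) (λ c → e * ratio (k c) n) →
  0ℚ ≤ ratio m n + (C + ℚΣ.sum (λ i → ratio (k i) n * d i))
rate-bound {b} {n} {m} {e} {C} k d 0<k ∑k≡n 0<n 0<e e≼C s≼d 1≤ = *-cancelʳ-≤′ (0<nat 0<n) (begin
  0ℚ * nat n
    ≡⟨ *-zeroˡ (nat n) ⟩
  0ℚ
    ≤⟨ logBound-exponent m (∏ℓ-pos cs 0<es)
         (logBound-∏ℓ cs {q = λ c → C + d c} 0<es (λ c → logBound-* 0<e (0<s c) e≼C (s≼d c))) 1≤ ⟩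
  nat m + ∑ℓ cs (λ c → C + d c)
    ≡⟨ cong₂ _+_ (sym (ratio*nat m 0<n)) (trans (∑ℓ-labels k (λ c → C + d c)) total) ⟩
  ratio m n * nat n + (C + T) * nat n
    ≡⟨ *-distribʳ-+ (nat n) (ratio m n) (C + T) ⟨
  (ratio m n + (C + T)) * nat n ∎)
  where
  open ≤-Reasoning
  cs = labels k
  s : Fin b → ℚ
  s i = ratio (k i) n
  0<s : ∀ i → 0ℚ < s i
  0<s i = 0<ratio (0<k i) 0<n
  0<es : ∀ i → 0ℚ < e * s i
  0<es i = 0<* 0<e (0<s i)
  T : ℚ
  T = ℚΣ.sum (λ i → s i * d i)
  total : ℚΣ.sum (λ i → nat (k i) * (C + d i)) ≡ (C + T) * nat n
  total = begin-equality
    ℚΣ.sum (λ i → nat (k i) * (C + d i))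
      ≡⟨ ℚΣ.sum-cong-≗ (λ i → trans (cong (_* (C + d i)) (sym (ratio*nat (k i) 0<n)))
           (trans (solve 4 (λ s n C d → s :* n :* (C :+ d) := s :* n :* C :+ s :* d :* n) refl (s i) (nat n) C (d i))
             (cong (λ x → x * C + s i * d i * nat n) (ratio*nat (k i) 0<n)))) ⟩
    ℚΣ.sum (λ i → nat (k i) * C + s i * d i * nat n)
      ≡⟨ ℚΣ.∑-distrib-+ (λ i → nat (k i) * C) (λ i → s i * d i * nat n) ⟩
    ℚΣ.sum (λ i → nat (k i) * C) + ℚΣ.sum (λ i → s i * d i * nat n)
      ≡⟨ cong₂ _+_ (ℚΣ.*-distribʳ-sum C (λ i → nat (k i))) (ℚΣ.*-distribʳ-sum (nat n) (λ i → s i * d i)) ⟨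
    ℚΣ.sum (λ i → nat (k i)) * C + T * nat n
      ≡⟨ cong (λ x → x * C + T * nat n) (trans (sym (nat-sum k)) (cong nat ∑k≡n)) ⟩
    nat n * C + T * nat n
      ≡⟨ solve 3 (λ n C T → n :* C :+ T :* n := (C :+ T) :* n) refl (nat n) C T ⟩
    (C + T) * nat n ∎

theorem1 : (b : ℕ) → 1 ℕ.≤ b →
    (p : Fin b → ℝ) (p>0 : ∀ i → 0ᵣ <ᵣ p i) → ∑ p ≃ᵣ 1ᵣ →
    (ε⁺ : ℝ) (ε⁺>0 : 0ᵣ <ᵣ ε⁺) → ε⁺ <ᵣ fromℚ (+ 1 / 8) →
    (u m : ℕ → ℕ) →
    (∀ (δ : ℚ) → 0ℚ < δ →
    Eventually (Admissible p) (λ n → 0 ℕ.< u n × ratio n (u n) < δ)) →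
    (∀ n → Admissible p n →
    Σ (DataStructure (m n) (u n) b) (λ D → EncodesAll D p n ε⁺ 0ᵣ 0ᵣ)) →
    ∀ (δ : ℚ) → 0ℚ < δ →
    Eventually (Admissible p) (λ n →
    fromℚ (ratio (m n) n)
    ≥ᵣ log (inverse ε⁺ ε⁺>0) (inverse-pos ε⁺ ε⁺>0) +ᵣ entropy p p>0 -ᵣ fromℚ δ)
theorem1 b _ p p>0 ∑p≃1 ε⁺ ε⁺>0 _ u m n/u→0 encoders δ 0<δ =
  let (t , 1<t , t≼δ) = small-log 0<δ
      (l , h , 0<l , l∈ , h∈ , h<lt) = approximate {ε⁺} ε⁺>0 1<t
  in eventually t t≼δ (<-trans 0<1 1<t) l h 0<l l∈ h∈ h<lt
  where
  conclusion : ℕ → Set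
  conclusion n = fromℚ (ratio (m n) n)
    ≥ᵣ log (inverse ε⁺ ε⁺>0) (inverse-pos ε⁺ ε⁺>0) +ᵣ entropy p p>0 -ᵣ fromℚ δ
  module _ (t : ℚ) (t≼δ : LogBound t δ) (0<t : 0ℚ < t) (l h : ℚ) (0<l : 0ℚ < l)
           (l∈ : lower ε⁺ l) (h∈ : upper ε⁺ h) (h<lt : h < l * t) where
    -- This is `e - h` for `e = l * t`, the share of the free positions into which the `n` keys must
    -- fit.
    κ : ℚ
    κ = l * t - h
    0<κ : 0ℚ < κ
    0<κ = <⇒0<- h<lt
    0<1+κ : 0ℚ < 1ℚ + κ
    0<1+κ = 0<+ 0<1 0<κ
    instance
      1+κ>0 = positive 0<1+κ
      1+κ≢0 = pos⇒nonZero (1ℚ + κ)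
    δ′ : ℚ
    δ′ = κ * 1/ (1ℚ + κ)
    δ′[1+κ]≡κ : δ′ * (1ℚ + κ) ≡ κ
    δ′[1+κ]≡κ = trans (*-assoc κ (1/ (1ℚ + κ)) (1ℚ + κ))
      (trans (cong (κ *_) (*-inverseˡ (1ℚ + κ))) (*-identityʳ κ))
    0<δ′ : 0ℚ < δ′
    0<δ′ = 0<* 0<κ (positive⁻¹ (1/ (1ℚ + κ)) {{1/pos⇒pos (1ℚ + κ)}})
    rate : ∀ n → Admissible p n → 0 ℕ.< u n × ratio n (u n) < δ′ → conclusion n
    -- Here `a`, `g` and `c` lie below `log (1 / ε⁺)`, the entropy and `-δ`, so that `- g` lies
    -- above the sum of the `p i * log (p i)`. The strictness of the conclusion comes from
    -- `δ < - c`.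
    rate n adm (0<u , n/u<δ′) {q} (a₁ , c , (a , g , a∈ , g∈ , a₁≤) , δ<-c , q≤) =
      let (k , 0<k , ∑k≡n , sizes , values) = frequencies {p = p} p>0 ∑p≃1 adm
          0<n = proj₁ adm
          (n<u , n≤) = sparse 0<κ 0<u δ′[1+κ]≡κ n/u<δ′ 0<n
          (D , encodes) = encoders n adm
          (d , s≼d , T≤-g) = upper-∑-log {p = p} p>0 values (λ i → 0<ratio (0<k i) 0<n) g∈
          l≼-a = lower-log-inverse {ε⁺} {l} {a} ε⁺>0 l∈ 0<l a∈
      in finish (rate-bound k d 0<k ∑k≡n 0<n (0<* 0<l 0<t) (logBound-* 0<l 0<t l≼-a t≼δ) s≼d
           (encoding-bound {p = p} {ε⁺} k 0<k ∑k≡n 0<n n<u sizes h∈ (0<* 0<l 0<t) n≤ D encodes)) T≤-g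
      where
      finish : ∀ {T} → 0ℚ ≤ ratio (m n) n + ((- a + δ) + T) → T ≤ - g → q < ratio (m n) n
      finish {T} 0≤ T≤-g = add-pos⇒<
        (+-mono-<-≤ (<⇒0<- δ<-c) (0≤+ (≤⇒0≤- T≤-g) (0≤+ 0≤ (0≤+ (≤⇒0≤- a₁≤) (≤⇒0≤- q≤)))))
        (solve 8 (λ q c δ g T R a a₁ → q :+ (:- c :- δ :+ (:- g :- T :+ ((R :+ (:- a :+ δ :+ T)) :+ (a :+ g :- a₁ :+ (a₁ :+ c :- q))))) := R)
          refl q c δ g T (ratio (m n) n) a a₁)
    eventually : Eventually (Admissible p) conclusion
    eventually =
      let (N , small) = n/u→0 δ′ 0<δ′
      in N , λ n N≤n adm → rate n adm (small n N≤n adm)
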